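{- Let $\mathscr D=\{d_1,\ldots,d_n\}$ be a set of positive integers with $d_1>d_2>\cdots>d_n$ and $\min\mathscr D=d_n=2$. Define $C^{\star}$ as follows. If $\sigma(\mathscr D)$ is even: let $\mathbf s=d_1,\ldots,d_n$, $c=\max_{1\le k\le n-1}\left\lceil \frac{ -\Delta_{\mathbf s}(k)}{\min\{k,2\}}\right\rceil$, and $C^{\star}=c$. If $\sigma(\mathscr D)$ is odd: let $r=\max\{i: d_i\text{ is odd}\}$, let $\mathbf s=d_1,\ldots,d_{r-1},(d_r)_2,d_{r+1},\ldots,d_n$, and $C^{\star}=\max_{1\le k\le n}\left\lceil \frac{ -\Delta_{\mathbf s}(k)}{\min\{k,2\}}\right\rceil$. Then \[ \ell_q(\mathscr D)=\tfrac12\big(\sigma(\mathscr D)+2C^{\star}\big)+\begin{cases}0 & \text{if }\sigma(\mathscr D)\text{ is even};\\ \tfrac12 d_r & \text{if }\sigma(\mathscr D)\text{ is odd}.\end{cases} \]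
   Context: All graphs are finite and simple. The degree set of a graph $G$ is the set of distinct degrees of its vertices. For a finite nonempty set $\mathscr D$ of positive integers, $\ell_q(\mathscr D)$ denotes the least number of edges of a simple graph whose degree set is exactly $\mathscr D$. $\sigma(\mathscr D)$ is the sum of the elements of $\mathscr D$. The notation $(d)_m$ denotes $m$ consecutive occurrences of $d$ in a sequence. For a sequence $\mathbf s=a_1,\ldots,a_p$ and $1\le k\le p$, define $\Delta_{\mathbf s}(k)=k(k-1)+\sum_{i=k+1}^{p}\min\{k,a_i\}-\sum_{i=1}^{k}a_i$.
   Formalization: The set is assumed to have at least two elements (n ≥ 2), since for 𝒟 = {2} the maximum over 1 ≤ k ≤ n−1 defining c is over an empty range and C⋆ is undefined. -}

module Defs where

open import Data.Bool using (Bool; true; false; if_then_else_; _∧_)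
open import Data.Nat as ℕ using (ℕ; zero; suc; _⊓_; _<ᵇ_)
open import Data.Nat.Properties using ()
open import Data.Fin using (Fin; toℕ)
open import Data.List using (List; []; _∷_; map; take; drop; length; allFin)
open import Data.Nat.ListAction using (sum)
open import Data.Bool.ListAction using (any)
open import Data.List.Membership.Propositional using (_∈_)
open import Data.Integer as ℤ using (ℤ; +_; -_; _-_; _⊔_)
open import Data.Integer.DivMod using (_/ℕ_)
open import Data.Product using (Σ; _×_; ∃)
open import Relation.Binary.PropositionalEquality using (_≡_)

record SimpleGraph (N : ℕ) : Set where
  field
    adj    : Fin N → Fin N → Bool
    sym    : ∀ i j → adj i j ≡ adj j i
    irrefl : ∀ i → adj i i ≡ false

open SimpleGraph public

bit : Bool → ℕ
bit true  = 1
bit false = 0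

degree : ∀ {N} → SimpleGraph N → Fin N → ℕ
degree G i = sum (map (λ j → bit (adj G i j)) (allFin _))

edgeCount : ∀ {N} → SimpleGraph N → ℕ
edgeCount G =
  sum (map (λ i → sum (map (λ j → bit ((toℕ i <ᵇ toℕ j) ∧ adj G i j)) (allFin _)))
           (allFin _))

HasDegreeSet : ∀ {N} → SimpleGraph N → List ℕ → Set
HasDegreeSet {N} G D =
  (∀ i → degree G i ∈ D) × (∀ d → d ∈ D → ∃ λ i → degree G i ≡ d)

IsLq : List ℕ → ℕ → Set
IsLq D e =
  (Σ ℕ λ N → Σ (SimpleGraph N) λ G → HasDegreeSet G D × edgeCount G ≡ e)
  × (∀ N (G : SimpleGraph N) → HasDegreeSet G D → e ℕ.≤ edgeCount G)

σ : List ℕ → ℕ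
σ = sum

odd : ℕ → Bool
odd zero = false
odd (suc zero) = true
odd (suc (suc n)) = odd n

Δ : List ℕ → ℕ → ℤ
Δ s k = + (k ℕ.* (k ℕ.∸ 1) ℕ.+ sum (map (k ⊓_) (drop k s))) - + sum (take k s)

-- ⌈ x / m ⌉ for positive m (_/ℕ_ is floor division)
ceilDiv : ℤ → (m : ℕ) → .{{ℕ.NonZero m}} → ℤ
ceilDiv x m = - ((- x) /ℕ m)

term : List ℕ → ℕ → ℤ
term s j = ceilDiv (- Δ s (suc j)) (suc j ⊓ 2)

-- maxTerm s m = max_{1 ≤ k ≤ m + 1} ⌈ -Δ_s(k) / min{k,2} ⌉
maxTerm : List ℕ → ℕ → ℤ
maxTerm s zero    = term s 0
maxTerm s (suc m) = maxTerm s m ⊔ term s (suc m)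

-- the element d_r, where r = max{ i : d_i odd } (0 if no odd element)
lastOdd : List ℕ → ℕ
lastOdd []       = 0
lastOdd (x ∷ xs) = if any odd xs then lastOdd xs else (if odd x then x else 0)

dupLastOdd : List ℕ → List ℕ
dupLastOdd []       = []
dupLastOdd (x ∷ xs) =
  if any odd xs then x ∷ dupLastOdd xs else (if odd x then x ∷ x ∷ xs else x ∷ xs)

-- C⋆ (for a list of length n ≥ 2)
Cstar : List ℕ → ℤ
Cstar D = if odd (σ D)
  then maxTerm (dupLastOdd D) (length D ℕ.∸ 1)   -- k = 1..n
  else maxTerm D (length D ℕ.∸ 2)                -- k = 1..n-1

twiceFormula : List ℕ → ℤ
twiceFormula D =
  + σ D ℤ.+ + 2 ℤ.* Cstar D ℤ.+ + (if odd (σ D) then lastOdd D else 0)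

{-# OPTIONS --safe #-}
module Submission where

-- Lower bound: the degrees of a graph with degree set D are D together with a list E of extra
-- degrees, all at least 2.  The Erdős–Gallai inequality for k vertices then bounds Σ_E min {k , e}
-- from below, hence also Σ_E e; parity supplies the rounding and, when σ(D) is odd, an odd e ≥ d_r
-- in E.  Upper bound: C⋆ is the least number of 2's which, appended to s, makes the Erdős–Gallai
-- inequalities true up to the last entry of s; beyond it every entry is 2 and they persist.
-- Sufficiency of the inequalities follows Choudum: lower the last maximal and the last nonzero
-- entry by one, realise that sequence, and restore both degrees by adding an edge or, if the two
-- vertices are already adjacent, by a switch.

open import Defs
open import Data.Bool using (Bool; true; false; if_then_else_; not; _xor_; _∧_; _∨_; T)
open import Data.Bool.ListAction using (any)
open import Data.Bool.Properties using (∧-comm; ∧-zeroʳ; ∨-comm; ∨-zeroʳ; not-involutive; xor-assoc; xor-same; xor-identityʳ)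
import Data.Bool.Properties as Bool
open import Data.Fin using (Fin; toℕ; fromℕ<)
import Data.Fin as Fin
open import Data.Fin.Properties using (toℕ-injective; toℕ<n; toℕ-fromℕ<; any?)
open import Data.Integer as ℤ using (-[1+_])
import Data.Integer.DivMod as ℤ
import Data.Integer.Properties as ℤ
import Data.Integer.Tactic.RingSolver as ℤSolver
open import Data.List using (List; []; _∷_; _++_; map; take; drop; allFin; length; lookup; replicate; tabulate)
open import Data.List.Properties using (map-cong; map-∘; map-id; map-++; map-tabulate; map-replicate; ++-assoc; ∷-injective; length-map; length-++; length-replicate; length-take; take-all; take++drop≡id)
open import Data.List.Membership.Propositional using (_∈_)
open import Data.List.Membership.Propositional.Properties using (∈-∃++; ∈-lookup; ∈-map⁺; ∈-map⁻; ∈-++⁺ˡ; ∈-++⁺ʳ; ∈-++⁻; ∈-insert; ∈-allFin)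
open import Data.List.Relation.Binary.Permutation.Propositional using (_↭_; ↭-trans; ↭-sym; ↭-refl; ↭-reflexive; prep; swap)
open import Data.List.Relation.Binary.Permutation.Propositional.Properties using (map⁺; ↭-map-inv; shift; ∈-resp-↭; ++⁺ˡ; ↭-length)
open import Data.List.Relation.Unary.All as All using (All; []; _∷_)
open import Data.List.Relation.Unary.AllPairs as AllPairs using (AllPairs; []; _∷_)
open import Data.List.Relation.Unary.Any using (here; there; index)
open import Data.List.Relation.Unary.Any.Properties using (lookup-index)
open import Data.List.Relation.Unary.Linked using (Linked)
open import Data.List.Relation.Unary.Linked.Properties using (Linked⇒AllPairs)
open import Data.List.Relation.Unary.Unique.Propositional using (Unique)
open import Data.Nat using (ℕ; zero; suc; _+_; _*_; _∸_; _≤_; _<_; _≥_; _>_; z≤n; s≤s; _≟_; _≤?_; _<?_; _⊓_)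
open import Data.Nat.ListAction using (sum)
open import Data.Nat.ListAction.Properties using (sum-++; sum-↭)
open import Data.Nat.Properties
open import Data.Nat.Tactic.RingSolver using (solve-∀)
open import Data.Product using (Σ; ∃; _×_; _,_; proj₁; proj₂)
open import Data.Sum using (_⊎_; inj₁; inj₂)
open import Data.Unit using (tt)
open import Function using (_∘_; id)
open import Relation.Binary.Definitions using (tri<; tri≈; tri>)
open import Relation.Binary.PropositionalEquality using (_≡_; _≢_; refl; trans; cong; cong₂; subst; subst₂; module ≡-Reasoning)
import Relation.Binary.PropositionalEquality as ≡
open import Relation.Nullary using (yes; no; does; contradiction)
open import Relation.Nullary.Decidable using (dec-true; dec-false; _×-dec_; ¬?)

-- Why min{k,2}, and why 2's alone suffice: let the extra degrees of a graph have sum 2h, in the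
-- even case. The inequality for k = 1 gains one per extra vertex, and there are at most h of them
-- since each degree is at least 2; for k ≥ 2 it gains at most the whole sum 2h. Exactly h copies of
-- 2 attain both bounds, so padding by 2's is best for every k at once. When σ(D) is odd, the odd
-- extra degree e may exceed d_r, and putting e in the place of the second d_r may destroy the order
-- of the sequence. This does no harm, because the necessary inequality is proved for any k
-- vertices, not only for those of largest degree. The difference e - d_r is charged to the excess
-- 2h. C⋆ is defined as an integer maximum and could a priori be negative. As D decreases strictly
-- down to 2, d_1 > n, so the inequality for k = 1 fails without padding. This makes C⋆ positive,
-- which is used once more for the inequality at k = 2 when s has only two entries.

-- Parity and partial sums

-- Certificate for a linear inequality: `e` is the slack by which the conclusion is weaker than the
-- hypothesis, and the equation is left to the ring solver.
≤-from : ∀ e {a b A B} → a ≤ b → A + b + e ≡ B + a → A ≤ B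
≤-from e {a} {b} {A} {B} a≤b eq = +-cancelʳ-≤ b A B (begin
  A + b      ≤⟨ m≤m+n (A + b) e ⟩
  A + b + e  ≡⟨ eq ⟩
  B + a      ≤⟨ +-monoʳ-≤ B a≤b ⟩
  B + b      ∎)
  where open ≤-Reasoning

odd-suc : ∀ n → odd (suc n) ≡ not (odd n)
odd-suc zero          = refl
odd-suc (suc zero)    = refl
odd-suc (suc (suc n)) = odd-suc n

odd-+ : ∀ m n → odd (m + n) ≡ odd m xor odd n
odd-+ zero          n = refl
odd-+ (suc zero)    n = odd-suc n
odd-+ (suc (suc m)) n = odd-+ m n

odd-+-cancel : ∀ m {n} → odd m ≡ true → odd (m + n) ≡ true → odd n ≡ false
odd-+-cancel m {n} om om+n = trans (≡.sym (not-involutive (odd n)))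
  (cong not (trans (≡.sym (trans (odd-+ m n) (cong (_xor odd n) om))) om+n))

odd-double : ∀ n → odd (n + n) ≡ false
odd-double zero    = refl
odd-double (suc n) rewrite +-suc n n = odd-double n

half : ∀ n → odd n ≡ false → ∃ λ h → n ≡ h + h
half zero          _  = 0 , refl
half (suc (suc n)) ev with half n ev
... | h , refl = suc h , cong suc (≡.sym (+-suc h h))

odd-pronic : ∀ k → odd (suc k * k) ≡ false
odd-pronic zero    = refl
odd-pronic (suc k) = trans (cong odd (lem k))
  (trans (odd-+ (suc k + suc k) (suc k * k))
         (cong₂ _xor_ (odd-double (suc k)) (odd-pronic k)))
  where
  lem : ∀ k → suc (suc k) * suc k ≡ (suc k + suc k) + suc k * k
  lem = solve-∀

psum : (ℕ → ℕ) → ℕ → ℕ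
psum f zero    = 0
psum f (suc n) = psum f n + f n

psum-cong : ∀ {f g} n → (∀ i → i < n → f i ≡ g i) → psum f n ≡ psum g n
psum-cong zero    eq = refl
psum-cong (suc n) eq = cong₂ _+_ (psum-cong n (λ i i<n → eq i (m<n⇒m<1+n i<n))) (eq n ≤-refl)

psum-+ : ∀ f g n → psum (λ i → f i + g i) n ≡ psum f n + psum g n
psum-+ f g zero    = refl
psum-+ f g (suc n) rewrite psum-+ f g n = lem (psum f n) (psum g n) (f n) (g n)
  where
  lem : ∀ a b c d → (a + b) + (c + d) ≡ (a + c) + (b + d)
  lem = solve-∀

psum-const : ∀ d n → psum (λ _ → d) n ≡ n * d
psum-const d zero    = refl
psum-const d (suc n) rewrite psum-const d n = +-comm (n * d) d

psum-front : ∀ f n → psum f (suc n) ≡ f 0 + psum (f ∘ suc) n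
psum-front f zero    = ≡.sym (+-identityʳ (f 0))
psum-front f (suc n) = trans (cong (_+ f (suc n)) (psum-front f n))
                             (+-assoc (f 0) (psum (f ∘ suc) n) (f (suc n)))

psum-mono : ∀ f {m n} → m ≤ n → psum f m ≤ psum f n
psum-mono f {n = zero}  z≤n = ≤-refl
psum-mono f {n = suc n} m≤sn with m≤n⇒m<n∨m≡n m≤sn
... | inj₁ (s≤s m≤n) = ≤-trans (psum-mono f m≤n) (m≤m+n (psum f n) (f n))
... | inj₂ refl      = ≤-refl

δ : ℕ → ℕ → ℕ
δ a i = bit (does (i ≟ a))

δ-same : ∀ a → δ a a ≡ 1
δ-same a = cong bit (dec-true (a ≟ a) refl)

δ-diff : ∀ {a i} → i ≢ a → δ a i ≡ 0
δ-diff {a} {i} i≢a = cong bit (dec-false (i ≟ a) i≢a)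

psum-δ-≤ : ∀ a n → n ≤ a → psum (δ a) n ≡ 0
psum-δ-≤ a zero    _   = refl
psum-δ-≤ a (suc n) n<a rewrite psum-δ-≤ a n (<⇒≤ n<a) = δ-diff (<⇒≢ n<a)

psum-δ-> : ∀ a n → a < n → psum (δ a) n ≡ 1
psum-δ-> a (suc n) a<sn with m≤n⇒m<n∨m≡n (≤-pred a<sn)
... | inj₁ a<n  rewrite psum-δ-> a n a<n | δ-diff (>⇒≢ a<n) = refl
... | inj₂ refl rewrite psum-δ-≤ a a ≤-refl = δ-same a

-- Choudum's reduction preserves the Erdős-Gallai inequalities

-- The Erdős–Gallai inequalities with the minimum linearised: bounding min {k , f i} by k for
-- i ≤ m and by f i beyond gives Σ_{i<k} f i ≤ k m + Σ_{m<i<q} f i.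
EG : (ℕ → ℕ) → ℕ → Set
EG f q = ∀ k m → k ≤ suc m → m < q → psum f k + psum f (suc m) ≤ k * m + psum f q

Antitone : (ℕ → ℕ) → Set
Antitone f = ∀ i → f (suc i) ≤ f i

antitone-≤ : ∀ {f} → Antitone f → ∀ {i j} → i ≤ j → f j ≤ f i
antitone-≤ {f} anti {j = zero}  z≤n = ≤-refl
antitone-≤ {f} anti {j = suc j} i≤sj with m≤n⇒m<n∨m≡n i≤sj
... | inj₁ (s≤s i≤j) = ≤-trans (anti j) (antitone-≤ anti i≤j)
... | inj₂ refl      = ≤-refl

-- Choudum's reduction: lower by one the last entry t of the initial plateau and the last entry w.
module _ (f f′ : ℕ → ℕ) (t w e : ℕ) (t<w : t < w) (plateau : ∀ i → i ≤ t → f i ≡ suc e)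
         (1≤fw : 1 ≤ f w) (f≡ : ∀ i → f i ≡ f′ i + (δ t i + δ w i))
         (even : odd (psum f (suc w)) ≡ false) (eg : EG f (suc w)) where

  private
    d  = suc e
    S  = psum f
    S′ = psum f′
    Q  = S (suc w)

    S-split : ∀ n → S n ≡ S′ n + (psum (δ t) n + psum (δ w) n)
    S-split n = trans (psum-cong n (λ i _ → f≡ i)) (trans (psum-+ f′ (λ i → δ t i + δ w i) n)
                  (cong (S′ n +_) (psum-+ (δ t) (δ w) n)))

    S′≤S : ∀ n → S′ n ≤ S n
    S′≤S n = ≤-trans (m≤m+n (S′ n) _) (≤-reflexive (≡.sym (S-split n)))

    S-before : ∀ {n} → n ≤ t → S n ≡ S′ n
    S-before {n} n≤t rewrite S-split n | psum-δ-≤ t n n≤t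
      | psum-δ-≤ w n (≤-trans n≤t (<⇒≤ t<w)) = +-identityʳ (S′ n)

    S-between : ∀ {n} → t < n → n ≤ w → S n ≡ suc (S′ n)
    S-between {n} t<n n≤w rewrite S-split n | psum-δ-> t n t<n | psum-δ-≤ w n n≤w = +-comm (S′ n) 1

  psum-reduce : psum f (suc w) ≡ 2 + psum f′ (suc w)
  psum-reduce = trans (S-split (suc w)) (trans
    (cong₂ (λ x y → S′ (suc w) + (x + y)) (psum-δ-> t (suc w) (m<n⇒m<1+n t<w)) (psum-δ-> w (suc w) ≤-refl))
    (+-comm (S′ (suc w)) 2))

  private
    S-plateau : ∀ {n} → n ≤ suc t → S n ≡ n * d
    S-plateau {n} n≤st = trans (psum-cong n (λ i i<n → plateau i (≤-pred (≤-trans i<n n≤st)))) (psum-const d n)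

    S<Q : ∀ {n} → n ≤ w → suc (S n) ≤ Q
    S<Q {n} n≤w = ≤-trans (≤-reflexive (+-comm 1 (S n))) (+-mono-≤ (psum-mono f n≤w) 1≤fw)

    plateau<Q : suc (suc t * d) ≤ Q
    plateau<Q = ≤-trans (≤-reflexive (cong suc (≡.sym (S-plateau ≤-refl)))) (S<Q t<w)

    -- Supplies the one unit missing when only the second sum on the left contains a lowered entry.
    -- For d ≤ m it comes from the positive entry at `w`, which lies beyond m. For d > m it comes
    -- from the inequality for k + 1, whose additional term d on the left exceeds the additional m
    -- on the right.
    slack-beyond : ∀ {k m} → k ≤ t → t ≤ m → m < w → suc (k * d + S (suc m)) ≤ k * m + Q
    slack-beyond {k} {m} k≤t t≤m m<w with d ≤? m
    ... | yes d≤m = ≤-trans (≤-reflexive (≡.sym (+-suc (k * d) (S (suc m)))))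
                            (+-mono-≤ (*-monoʳ-≤ k d≤m) (S<Q m<w))
    ... | no d≰m  = ≤-from 0 (+-mono-≤ (≰⇒> d≰m)
                      (subst (λ x → x + S (suc m) ≤ suc k * m + Q) (S-plateau (s≤s k≤t))
                         (eg (suc k) m (s≤s (≤-trans k≤t t≤m)) (m<n⇒m<1+n m<w))))
                      (lem (k * d) (k * m) d m (S (suc m)) Q)
      where
      lem : ∀ kd km d m s q → suc (kd + s) + (d + ((m + km) + q)) + 0
                              ≡ (km + q) + (suc m + ((d + kd) + s))
      lem = solve-∀

    -- Supplies the two units missing when both sums on the left end before `t`, so that everything
    -- on the left is a multiple of d.
    slack-within : ∀ {k m} → k ≤ suc m → m < t → 2 + (k * d + suc m * d) ≤ k * m + Q
    slack-within {k} {m} k≤sm m<t with d ≤? m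
    ... | yes d≤m = ≤-from e (+-mono-≤ (*-monoʳ-≤ k d≤m) (+-mono-≤ (*-monoˡ-≤ d (s≤s m<t)) plateau<Q))
                      (lem (k * d) (k * m) m t e Q)
      where
      lem : ∀ kd km m t e Q → 2 + (kd + suc m * suc e) + (km + (suc t * suc e + Q)) + e
              ≡ (km + Q) + (kd + (suc (suc m) * suc e + suc (suc t * suc e)))
      lem = solve-∀
    ... | no d≰m with k <? d
    ...   | yes k<d with m≤n⇒∃[o]m+o≡n m<t
    -- Start from the slack of one at m = t. Going back to the given m removes d from the left and k
    -- from the right j + 1 times, and d > k yields the second unit.
    ...     | j , refl = ≤-from j (+-mono-≤
                (subst (λ x → suc (k * d + x) ≤ k * t + Q) (S-plateau ≤-refl)
                  (slack-beyond (≤-trans k≤sm m<t) ≤-refl t<w))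
                (*-monoʳ-≤ (suc j) k<d))
                (lem k m j d Q)
      where
      lem : ∀ k m j d Q → 2 + (k * d + suc m * d) + ((k * (suc m + j) + Q) + suc j * d) + j
              ≡ (k * m + Q) + (suc (k * d + suc (suc m + j) * d) + suc j * suc k)
      lem = solve-∀
    slack-within {k} {m} k≤sm m<t | no d≰m | no k≮d
      with ≤-antisym k≤sm (≤-trans (≰⇒> d≰m) (≮⇒≥ k≮d)) | ≤-antisym (≮⇒≥ k≮d) (≤-trans k≤sm (≰⇒> d≰m))
    -- What remains is k = m + 1 = d, where the claim becomes d (d + 1) + 2 ≤ `Q`. The plateau has t
    -- + 1 > d entries; if it has more than d + 1, its sum is large enough.
    ... | refl | refl with m≤n⇒m<n∨m≡n m<t
    ...   | inj₁ d<t = ≤-from e (+-mono-≤ (*-monoˡ-≤ d (s≤s d<t)) plateau<Q) (lem e t Q)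
      where
      lem : ∀ e t Q → 2 + (suc e * suc e + suc e * suc e) + (suc t * suc e + Q) + e
              ≡ (suc e * e + Q) + (suc (suc (suc e)) * suc e + suc (suc t * suc e))
      lem = solve-∀
    ...   | inj₂ refl with m≤n⇒m<n∨m≡n plateau<Q
    ...     | inj₁ bound = ≤-from 0 bound (lem e Q)
      where
      lem : ∀ e Q → 2 + (suc e * suc e + suc e * suc e) + Q + 0
              ≡ (suc e * e + Q) + suc (suc (suc (suc e) * suc e))
      lem = solve-∀
    -- A plateau of exactly d + 1 entries leaves only `Q` = d (d + 1) + 1 to exclude. That number is
    -- odd, while the degree sum is even.
    ...     | inj₂ tight = contradiction
                (trans (≡.sym even) (trans (cong odd (≡.sym tight))
                  (trans (odd-suc (suc d * d)) (cong not (odd-pronic d)))))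
                λ ()

  -- The right side loses two. For m < w the left side loses two if t < k, one if k ≤ t ≤ m and
  -- nothing if m < t; the slack lemmas make up the difference. For m = w the total cancels from
  -- both sides.
  reduce-EG : EG f′ (suc w)
  reduce-EG k m k≤sm m<sw with m≤n⇒m<n∨m≡n (≤-pred m<sw)
  ... | inj₂ refl = +-monoˡ-≤ (S′ (suc w)) (≤-trans (S′≤S k) (+-cancelʳ-≤ Q (S k) (k * m) (eg k m k≤sm m<sw)))
  ... | inj₁ m<w with t <? k
  ...   | yes t<k = ≤-from 0 (subst₂ _≤_
            (cong₂ _+_ (S-between t<k (≤-trans k≤sm m<w)) (S-between (≤-trans t<k k≤sm) m<w))
            (cong (k * m +_) psum-reduce) (eg k m k≤sm m<sw))
            (lem (S′ k) (S′ (suc m)) (k * m) (S′ (suc w)))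
    where
    lem : ∀ a b c d → a + b + (c + (2 + d)) + 0 ≡ c + d + (suc a + suc b)
    lem = solve-∀
  ...   | no t≮k with t ≤? m
  ...     | yes t≤m = ≤-from 0 (subst₂ _≤_
              (cong suc (cong₂ _+_ (trans (≡.sym (S-plateau (m≤n⇒m≤1+n (≮⇒≥ t≮k)))) (S-before (≮⇒≥ t≮k)))
                                   (S-between (s≤s t≤m) m<w)))
              (cong (k * m +_) psum-reduce) (slack-beyond (≮⇒≥ t≮k) t≤m m<w))
              (lem (S′ k) (S′ (suc m)) (k * m) (S′ (suc w)))
    where
    lem : ∀ a b c d → a + b + (c + (2 + d)) + 0 ≡ c + d + suc (a + suc b)
    lem = solve-∀
  ...     | no t≰m = ≤-from 0 (subst₂ _≤_
              (cong (2 +_) (cong₂ _+_ (trans (≡.sym (S-plateau (m≤n⇒m≤1+n (≮⇒≥ t≮k)))) (S-before (≮⇒≥ t≮k)))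
                                   (trans (≡.sym (S-plateau (m≤n⇒m≤1+n (≰⇒> t≰m)))) (S-before (≰⇒> t≰m)))))
              (cong (k * m +_) psum-reduce) (slack-within k≤sm (≰⇒> t≰m)))
              (lem (S′ k) (S′ (suc m)) (k * m) (S′ (suc w)))
    where
    lem : ∀ a b c d → a + b + (c + (2 + d)) + 0 ≡ c + d + (2 + (a + b))
    lem = solve-∀

-- Sums over vertices, edge toggling and the switch

module _ {A : Set} where

  sum-map-cong : {f g : A → ℕ} → (∀ x → f x ≡ g x) → ∀ xs → sum (map f xs) ≡ sum (map g xs)
  sum-map-cong eq xs = cong sum (map-cong eq xs)

  sum-map-+ : ∀ (f g : A → ℕ) xs → sum (map (λ x → f x + g x) xs) ≡ sum (map f xs) + sum (map g xs)
  sum-map-+ f g []       = refl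
  sum-map-+ f g (x ∷ xs) rewrite sum-map-+ f g xs = lem (f x) (g x) (sum (map f xs)) (sum (map g xs))
    where
    lem : ∀ a b c d → (a + b) + (c + d) ≡ (a + c) + (b + d)
    lem = solve-∀

  sum-map-* : ∀ c (f : A → ℕ) xs → sum (map (λ x → c * f x) xs) ≡ c * sum (map f xs)
  sum-map-* c f []       = ≡.sym (*-zeroʳ c)
  sum-map-* c f (x ∷ xs) rewrite sum-map-* c f xs = ≡.sym (*-distribˡ-+ c (f x) (sum (map f xs)))

  sum-map-≤ : {f g : A → ℕ} → (∀ x → f x ≤ g x) → ∀ xs → sum (map f xs) ≤ sum (map g xs)
  sum-map-≤ f≤g []       = ≤-refl
  sum-map-≤ f≤g (x ∷ xs) = +-mono-≤ (f≤g x) (sum-map-≤ f≤g xs)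

∑ : ∀ {N} → (Fin N → ℕ) → ℕ
∑ f = sum (map f (allFin _))

∑-toℕ : ∀ N (h : ℕ → ℕ) → ∑ {N} (h ∘ toℕ) ≡ psum h N
∑-toℕ zero    h = refl
∑-toℕ (suc N) h = begin
  h 0 + sum (map (h ∘ toℕ) (tabulate {n = N} Fin.suc))
    ≡⟨ cong (λ xs → h 0 + sum xs) (trans (map-tabulate {n = N} Fin.suc (h ∘ toℕ))
                                         (≡.sym (map-tabulate {n = N} id (h ∘ suc ∘ toℕ)))) ⟩
  h 0 + ∑ {N} (h ∘ suc ∘ toℕ)
    ≡⟨ cong (h 0 +_) (∑-toℕ N (h ∘ suc)) ⟩
  h 0 + psum (h ∘ suc) N
    ≡⟨ psum-front h N ⟨
  psum h (suc N) ∎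
  where open ≡-Reasoning

_≐_ : ∀ {N} → Fin N → Fin N → Bool
i ≐ j = does (toℕ i ≟ toℕ j)

𝟙 : ∀ {N} → Fin N → Fin N → ℕ
𝟙 a i = δ (toℕ a) (toℕ i)

≐⇒≡ : ∀ {N} (i j : Fin N) → (i ≐ j) ≡ true → i ≡ j
≐⇒≡ i j eq = toℕ-injective (≡ᵇ⇒≡ (toℕ i) (toℕ j) (subst T (≡.sym eq) tt))

𝟙-diff : ∀ {N} {a i : Fin N} → i ≢ a → 𝟙 a i ≡ 0
𝟙-diff i≢a = δ-diff (i≢a ∘ toℕ-injective)

∑-𝟙 : ∀ {N} (a : Fin N) → ∑ (𝟙 a) ≡ 1
∑-𝟙 {N} a = trans (∑-toℕ N (δ (toℕ a))) (psum-δ-> (toℕ a) N (toℕ<n a))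

module _ {N : ℕ} where

  isPair : Fin N → Fin N → Fin N → Fin N → Bool
  isPair a b i j = ((i ≐ a) ∧ (j ≐ b)) ∨ ((i ≐ b) ∧ (j ≐ a))

  isPair-sym : ∀ a b i j → isPair a b i j ≡ isPair a b j i
  isPair-sym a b i j = trans (∨-comm ((i ≐ a) ∧ (j ≐ b)) _)
    (cong₂ _∨_ (∧-comm (i ≐ b) (j ≐ a)) (∧-comm (i ≐ a) (j ≐ b)))

  ≐-disjoint : ∀ {a b : Fin N} → a ≢ b → ∀ i → (i ≐ a) ∧ (i ≐ b) ≡ false
  ≐-disjoint {a} {b} a≢b i with i ≐ a in p | i ≐ b in q
  ... | true  | true  = contradiction (trans (≡.sym (≐⇒≡ i a p)) (≐⇒≡ i b q)) a≢b
  ... | true  | false = refl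
  ... | false | _     = refl

  isPair-irrefl : ∀ {a b} → a ≢ b → ∀ i → isPair a b i i ≡ false
  isPair-irrefl {a} {b} a≢b i =
    cong₂ _∨_ (≐-disjoint a≢b i) (trans (∧-comm (i ≐ b) (i ≐ a)) (≐-disjoint a≢b i))

  isPair-self : ∀ a b → isPair a b a b ≡ true
  isPair-self a b rewrite dec-true (toℕ a ≟ toℕ a) refl | dec-true (toℕ b ≟ toℕ b) refl = refl

  toggle : (G : SimpleGraph N) (a b : Fin N) → a ≢ b → SimpleGraph N
  toggle G a b a≢b .adj i j  = adj G i j xor isPair a b i j
  toggle G a b a≢b .sym i j  = cong₂ _xor_ (sym G i j) (isPair-sym a b i j)
  toggle G a b a≢b .irrefl i = cong₂ _xor_ (irrefl G i) (isPair-irrefl a≢b i)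

  degree-cong : ∀ {G H : SimpleGraph N} → (∀ i j → adj G i j ≡ adj H i j) → ∀ i → degree G i ≡ degree H i
  degree-cong eq i = sum-map-cong (λ j → cong bit (eq i j)) (allFin N)

  module _ (G : SimpleGraph N) (a b : Fin N) (a≢b : a ≢ b) where

    private
      bit-xor : ∀ x p q r s → (p ∧ q ≡ true → x ≡ false) → (r ∧ s ≡ true → x ≡ false) → p ∧ r ≡ false →
                bit (x xor (p ∧ q ∨ r ∧ s)) ≡ bit x + (bit p * bit q + bit r * bit s)
      bit-xor x true  true  false s     h₁ h₂ h₃ rewrite h₁ refl = refl
      bit-xor x true  false false s     h₁ h₂ h₃ rewrite xor-identityʳ x = ≡.sym (+-identityʳ (bit x))
      bit-xor x false q     true  true  h₁ h₂ h₃ rewrite h₂ refl = refl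
      bit-xor x false q     true  false h₁ h₂ h₃ rewrite xor-identityʳ x = ≡.sym (+-identityʳ (bit x))
      bit-xor x false q     false s     h₁ h₂ h₃ rewrite xor-identityʳ x = ≡.sym (+-identityʳ (bit x))

      both : ∀ {p q} → p ∧ q ≡ true → p ≡ true × q ≡ true
      both {true} {true} _ = refl , refl

      nonadjacent : adj G a b ≡ false → ∀ i j → (i ≐ a) ∧ (j ≐ b) ≡ true → adj G i j ≡ false
      nonadjacent na i j eq with both eq
      ... | p , q with ≐⇒≡ i a p | ≐⇒≡ j b q
      ... | refl | refl = na

    degree-toggle-add : adj G a b ≡ false → ∀ i → degree (toggle G a b a≢b) i ≡ degree G i + (𝟙 a i + 𝟙 b i)
    degree-toggle-add na i = begin
      degree (toggle G a b a≢b) i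
        ≡⟨ sum-map-cong (λ j → bit-xor (adj G i j) (i ≐ a) (j ≐ b) (i ≐ b) (j ≐ a)
              (nonadjacent na i j)
              (λ eq → trans (sym G i j) (nonadjacent na j i (trans (∧-comm (j ≐ a) (i ≐ b)) eq)))
              (≐-disjoint a≢b i)) (allFin N) ⟩
      ∑ (λ j → bit (adj G i j) + (𝟙 a i * 𝟙 b j + 𝟙 b i * 𝟙 a j))
        ≡⟨ sum-map-+ (λ j → bit (adj G i j)) _ (allFin N) ⟩
      degree G i + ∑ (λ j → 𝟙 a i * 𝟙 b j + 𝟙 b i * 𝟙 a j)
        ≡⟨ cong (degree G i +_) (sum-map-+ (λ j → 𝟙 a i * 𝟙 b j) _ (allFin N)) ⟩
      degree G i + (∑ (λ j → 𝟙 a i * 𝟙 b j) + ∑ (λ j → 𝟙 b i * 𝟙 a j))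
        ≡⟨ cong (degree G i +_) (cong₂ _+_ (scale (𝟙 a i) b) (scale (𝟙 b i) a)) ⟩
      degree G i + (𝟙 a i + 𝟙 b i) ∎
      where
      open ≡-Reasoning
      scale : ∀ c x → ∑ (λ j → c * 𝟙 x j) ≡ c
      scale c x = trans (sum-map-* c (𝟙 x) (allFin N)) (trans (cong (c *_) (∑-𝟙 x)) (*-identityʳ c))

  -- Toggling is an involution, so removing an edge is adding it to the toggled graph, read
  -- backwards; this form avoids subtraction.
  degree-toggle-remove : ∀ (G : SimpleGraph N) a b (a≢b : a ≢ b) → adj G a b ≡ true →
                         ∀ i → degree G i ≡ degree (toggle G a b a≢b) i + (𝟙 a i + 𝟙 b i)
  degree-toggle-remove G a b a≢b ad i = trans
    (degree-cong {G} {toggle (toggle G a b a≢b) a b a≢b} (λ i j → ≡.sym (trans (xor-assoc (adj G i j) _ _)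
       (trans (cong (adj G i j xor_) (xor-same (isPair a b i j))) (xor-identityʳ (adj G i j))))) i)
    (degree-toggle-add (toggle G a b a≢b) a b a≢b (cong₂ _xor_ ad (isPair-self a b)) i)

  toggle-elsewhere : ∀ (G : SimpleGraph N) a b (a≢b : a ≢ b) {i j} → i ≢ a ⊎ j ≢ b → i ≢ b ⊎ j ≢ a →
                     adj (toggle G a b a≢b) i j ≡ adj G i j
  toggle-elsewhere G a b a≢b {i} {j} p q =
    trans (cong (adj G i j xor_) (cong₂ _∨_ (off p) (off q))) (xor-identityʳ (adj G i j))
    where
    off : ∀ {x y} → i ≢ x ⊎ j ≢ y → (i ≐ x) ∧ (j ≐ y) ≡ false
    off {x} {y} (inj₁ i≢x) rewrite dec-false (toℕ i ≟ toℕ x) (i≢x ∘ toℕ-injective) = refl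
    off {x} {y} (inj₂ j≢y) rewrite dec-false (toℕ j ≟ toℕ y) (j≢y ∘ toℕ-injective) = ∧-zeroʳ (i ≐ x)

  adj⇒≢ : ∀ (G : SimpleGraph N) {i j} → adj G i j ≡ true → i ≢ j
  adj⇒≢ G {i} ad refl = contradiction (trans (≡.sym ad) (irrefl G i)) λ ()

  -- Compare the neighbourhoods of m and w with each other's membership discounted: t lies only in
  -- that of w, so the degree condition forces some l to lie only in that of m.
  private-neighbour : ∀ (G : SimpleGraph N) {t w m} → m ≢ t → m ≢ w → adj G t w ≡ true → adj G t m ≡ false →
    degree G w ≤ degree G m → ∃ λ l → adj G m l ≡ true × adj G w l ≡ false × l ≢ w
  private-neighbour G {t} {w} {m} m≢t m≢w tw tm w≤m
    with any? (λ l → (adj G m l Bool.≟ true) ×-dec (adj G w l Bool.≟ false) ×-dec ¬? (l Fin.≟ w))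
  ... | yes found = found
  ... | no none = contradiction total (<⇒≱ (+-monoˡ-< b (s≤s w≤m)))
    where
    b = bit (adj G m w)
    pointwise : ∀ l → bit (adj G m l) + (𝟙 t l + b * 𝟙 m l) ≤ bit (adj G w l) + b * 𝟙 w l
    pointwise l with l Fin.≟ w
    ... | yes refl rewrite irrefl G l | δ-same (toℕ l) | 𝟙-diff {a = t} (adj⇒≢ G tw ∘ ≡.sym)
                         | 𝟙-diff {a = m} (m≢w ∘ ≡.sym) | *-zeroʳ b | *-identityʳ b = ≤-reflexive (+-identityʳ b)
    ... | no l≢w with l Fin.≟ m
    ...   | yes refl rewrite irrefl G l | δ-same (toℕ l) | 𝟙-diff {a = t} m≢t
                         | 𝟙-diff {a = w} m≢w | sym G w l | *-zeroʳ b | *-identityʳ b = ≤-reflexive (≡.sym (+-identityʳ b))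
    ...   | no l≢m with l Fin.≟ t
    ...     | yes refl rewrite sym G m l | tm | sym G w l | tw | δ-same (toℕ l) | 𝟙-diff {a = m} l≢m | *-zeroʳ b = s≤s z≤n
    ...     | no l≢t rewrite 𝟙-diff {a = t} l≢t | 𝟙-diff {a = m} l≢m | 𝟙-diff {a = w} l≢w | *-zeroʳ b
                with adj G m l in p | adj G w l in q
    ...       | true  | true  = ≤-refl
    ...       | true  | false = contradiction (l , p , q , l≢w) none
    ...       | false | _     = z≤n
    total : suc (degree G m) + b ≤ degree G w + b
    total = subst₂ _≤_
      (trans (sum-map-+ (λ l → bit (adj G m l)) _ (allFin N))
        (trans (cong (degree G m +_) (trans (sum-map-+ (𝟙 t) _ (allFin N)) (cong₂ _+_ (∑-𝟙 t) (scale m))))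
               (+-suc (degree G m) b)))
      (trans (sum-map-+ (λ l → bit (adj G w l)) _ (allFin N)) (cong (degree G w +_) (scale w)))
      (sum-map-≤ pointwise (allFin N))
      where
      scale : ∀ x → ∑ (λ j → b * 𝟙 x j) ≡ b
      scale x = trans (sum-map-* b (𝟙 x) (allFin N)) (trans (cong (b *_) (∑-𝟙 x)) (*-identityʳ b))

  -- If tw is already an edge, the edge ml is exchanged for tm and lw: m and l lose one neighbour
  -- and gain one, while t and w only gain.
  raise-degrees : ∀ (G : SimpleGraph N) {t w} → t ≢ w →
    (adj G t w ≡ true → ∃ λ m → m ≢ t × m ≢ w × adj G t m ≡ false × degree G w ≤ degree G m) →
    ∃ λ H → ∀ i → degree H i ≡ degree G i + (𝟙 t i + 𝟙 w i)
  raise-degrees G {t} {w} t≢w switch with adj G t w in tw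
  ... | false = toggle G t w t≢w , degree-toggle-add G t w t≢w tw
  ... | true with switch refl
  ...   | m , m≢t , m≢w , tm , w≤m with private-neighbour G m≢t m≢w tw tm w≤m
  ...     | l , ml , wl , l≢w = G₃ , degrees
    where
    m≢l : m ≢ l
    m≢l = adj⇒≢ G ml
    l≢t : l ≢ t
    l≢t refl = contradiction (trans (≡.sym ml) (trans (sym G m l) tm)) λ ()
    G₁ = toggle G m l m≢l
    G₂ = toggle G₁ t m (m≢t ∘ ≡.sym)
    G₃ = toggle G₂ l w l≢w
    tm₁ : adj G₁ t m ≡ false
    tm₁ = trans (toggle-elsewhere G m l m≢l (inj₁ (m≢t ∘ ≡.sym)) (inj₁ (l≢t ∘ ≡.sym))) tm
    lw₂ : adj G₂ l w ≡ false
    lw₂ = trans (toggle-elsewhere G₁ t m (m≢t ∘ ≡.sym) (inj₁ l≢t) (inj₁ (m≢l ∘ ≡.sym)))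
         (trans (toggle-elsewhere G m l m≢l (inj₁ (m≢l ∘ ≡.sym)) (inj₂ (m≢w ∘ ≡.sym))) (trans (sym G l w) wl))
    degrees : ∀ i → degree G₃ i ≡ degree G i + (𝟙 t i + 𝟙 w i)
    degrees i rewrite degree-toggle-remove G m l m≢l ml i | degree-toggle-add G₂ l w l≢w lw₂ i
      | degree-toggle-add G₁ t m (m≢t ∘ ≡.sym) tm₁ i = lem (degree G₁ i) (𝟙 t i) (𝟙 m i) (𝟙 l i) (𝟙 w i)
      where
      lem : ∀ g t m l w → g + (t + m) + (l + w) ≡ g + (m + l) + (t + w)
      lem = solve-∀

  emptyGraph : SimpleGraph N
  emptyGraph .adj _ _    = false
  emptyGraph .sym _ _    = refl
  emptyGraph .irrefl _   = refl

  -- Pigeonhole: t and its neighbours, w among them, are at most q - 1 vertices, so they cannot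
  -- exhaust the first q.
  nonneighbour : ∀ (G : SimpleGraph N) q → q ≤ N → ∀ {t w} → adj G t w ≡ true → 2 + degree G t ≤ q →
    ∃ λ m → toℕ m < q × m ≢ t × m ≢ w × adj G t m ≡ false
  nonneighbour G q q≤N {t} {w} tw small
    with any? (λ m → (toℕ m <? q) ×-dec ¬? (m Fin.≟ t) ×-dec ¬? (m Fin.≟ w) ×-dec (adj G t m Bool.≟ false))
  ... | yes found = found
  ... | no none = contradiction total (<⇒≱ small)
    where
    below : ℕ → ℕ
    below i = bit (does (i <? q))
    psum-below : ∀ n → n ≤ q → psum below n ≡ n
    psum-below zero    _   = refl
    psum-below (suc n) n<q rewrite psum-below n (<⇒≤ n<q) | dec-true (n <? q) n<q = +-comm n 1
    pointwise : ∀ m → below (toℕ m) ≤ 𝟙 t m + bit (adj G t m)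
    pointwise m with toℕ m <? q
    ... | no m≮q rewrite dec-false (toℕ m <? q) m≮q = z≤n
    ... | yes m<q rewrite dec-true (toℕ m <? q) m<q with m Fin.≟ t
    ...   | yes refl rewrite δ-same (toℕ t) = s≤s z≤n
    ...   | no m≢t with adj G t m in tm
    ...     | true  = m≤n+m 1 _
    ...     | false with m Fin.≟ w
    ...       | yes refl = contradiction (trans (≡.sym tm) tw) λ ()
    ...       | no m≢w = contradiction (m , m<q , m≢t , m≢w , tm) none
    total : q ≤ suc (degree G t)
    total = begin
      q                              ≡⟨ psum-below q ≤-refl ⟨
      psum below q                   ≤⟨ psum-mono below q≤N ⟩
      psum below N                   ≡⟨ ∑-toℕ N below ⟨
      ∑ {N} (below ∘ toℕ)            ≤⟨ sum-map-≤ pointwise (allFin N) ⟩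
      ∑ (λ m → 𝟙 t m + bit (adj G t m)) ≡⟨ sum-map-+ (𝟙 t) _ (allFin N) ⟩
      ∑ (𝟙 t) + degree G t           ≡⟨ cong (_+ degree G t) (∑-𝟙 t) ⟩
      suc (degree G t)               ∎
      where open ≤-Reasoning

-- Sufficiency of the Erdős-Gallai inequalities

-- The search stops at index `w` even if the plateau goes on. `realize` calls it with the index
-- before the last one, so that the two entries to be lowered are distinct also for a constant
-- sequence.
plateau-end : ∀ f w → Antitone f → ∃ λ t → t ≤ w × (∀ i → i ≤ t → f i ≡ f 0) × (f (suc t) < f t ⊎ t ≡ w)
plateau-end f zero    anti = 0 , z≤n , (λ { zero z≤n → refl }) , inj₂ refl
plateau-end f (suc w) anti with plateau-end f w anti
... | t , t≤w , flat , inj₁ drop = t , m≤n⇒m≤1+n t≤w , flat , inj₁ drop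
... | t , t≤w , flat , inj₂ refl with m≤n⇒m<n∨m≡n (anti t)
...   | inj₁ drop = t , m≤n⇒m≤1+n t≤w , flat , inj₁ drop
...   | inj₂ same = suc t , ≤-refl , flat′ , inj₂ refl
  where
  flat′ : ∀ i → i ≤ suc t → f i ≡ f 0
  flat′ i i≤st with m≤n⇒m<n∨m≡n i≤st
  ... | inj₁ (s≤s i≤t) = flat i i≤t
  ... | inj₂ refl      = trans same (flat t ≤-refl)

Realization : ℕ → (ℕ → ℕ) → Set
Realization N f = Σ (SimpleGraph N) λ G → ∀ i → degree G i ≡ f (toℕ i)

module _ (N : ℕ) where

  private
    degree-empty : ∀ i → degree (emptyGraph {N}) i ≡ 0
    degree-empty i = trans (∑-toℕ N (λ _ → 0)) (trans (psum-const 0 N) (*-zeroʳ N))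

    -- The measure `q + psum f q` drops by one when a trailing zero is discarded and by two at a
    -- reduction. The vertex set stays `Fin N` throughout; vertices from q on are isolated.
    realize : ∀ fuel q f → q + psum f q ≤ fuel → q ≤ N → Antitone f → (∀ i → q ≤ i → f i ≡ 0) →
              odd (psum f q) ≡ false → EG f q → Realization N f
    realize fuel zero f _ _ _ vanish _ _ =
      emptyGraph , λ i → trans (degree-empty i) (≡.sym (vanish (toℕ i) z≤n))
    realize (suc fuel) (suc w) f (s≤s bound) q≤N anti vanish even eg with f w ≟ 0
    ... | yes fw≡0 = realize fuel w f (subst (λ x → w + x ≤ fuel) psum≡ bound) (<⇒≤ q≤N) anti vanish′
                       (subst (λ x → odd x ≡ false) psum≡ even)
                       (λ k m k≤sm m<w → subst (λ x → psum f k + psum f (suc m) ≤ k * m + x) psum≡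
                          (eg k m k≤sm (m<n⇒m<1+n m<w)))
      where
      psum≡ : psum f (suc w) ≡ psum f w
      psum≡ = trans (cong (psum f w +_) fw≡0) (+-identityʳ (psum f w))
      vanish′ : ∀ i → w ≤ i → f i ≡ 0
      vanish′ i w≤i with m≤n⇒m<n∨m≡n w≤i
      ... | inj₁ w<i  = vanish i w<i
      ... | inj₂ refl = fw≡0
    realize (suc fuel) (suc zero) f _ _ _ _ _ eg | no f0≢0 =
      contradiction (n≤0⇒n≡0 (+-cancelʳ-≤ (f 0) (f 0) 0 (eg 1 0 ≤-refl ≤-refl))) f0≢0
    realize (suc fuel) (suc (suc v)) f (s≤s bound) q≤N anti vanish even eg | no fw≢0
      with plateau-end f v anti
    ... | t , t≤v , flat , end = proj₁ raised , λ i →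
          trans (proj₂ raised i) (trans
            (cong₂ _+_ (degrees i) (cong₂ (λ a b → δ a (toℕ i) + δ b (toℕ i)) t̂≡ ŵ≡))
            (≡.sym (f≡ (toℕ i))))
      where
      w = suc v
      t<w : t < w
      t<w = s≤s t≤v
      f′ : ℕ → ℕ
      f′ i = f i ∸ (δ t i + δ w i)
      f′≤f : ∀ i → f′ i ≤ f i
      f′≤f i = m∸n≤m (f i) (δ t i + δ w i)
      1≤fw : 1 ≤ f w
      1≤fw = n≢0⇒n>0 fw≢0
      1≤ft : 1 ≤ f t
      1≤ft = ≤-trans 1≤fw (antitone-≤ anti (<⇒≤ t<w))

      at-t : δ t t + δ w t ≡ 1
      at-t = cong₂ _+_ (δ-same t) (δ-diff (<⇒≢ t<w))
      at-w : δ t w + δ w w ≡ 1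
      at-w = cong₂ _+_ (δ-diff (>⇒≢ t<w)) (δ-same w)
      elsewhere : ∀ {i} → i ≢ t → i ≢ w → δ t i + δ w i ≡ 0
      elsewhere i≢t i≢w = cong₂ _+_ (δ-diff i≢t) (δ-diff i≢w)

      f≡ : ∀ i → f i ≡ f′ i + (δ t i + δ w i)
      f≡ i = ≡.sym (m∸n+n≡m fits)
        where
        fits : δ t i + δ w i ≤ f i
        fits with i ≟ t
        ... | yes refl = subst (_≤ f t) (≡.sym at-t) 1≤ft
        ... | no i≢t with i ≟ w
        ...   | yes refl = subst (_≤ f w) (≡.sym at-w) 1≤fw
        ...   | no i≢w = subst (_≤ f i) (≡.sym (elsewhere i≢t i≢w)) z≤n

      anti′ : Antitone f′
      anti′ i with i ≟ t
      ... | yes refl rewrite at-t = after-t end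
        where
        -- This is why the end of the plateau is lowered: the next entry is either strictly smaller
        -- already, or it is the last entry, which is lowered as well.
        after-t : f (suc t) < f t ⊎ t ≡ v → f′ (suc t) ≤ f t ∸ 1
        after-t (inj₁ drop) = ≤-trans (f′≤f (suc t)) (∸-monoˡ-≤ 1 drop)
        after-t (inj₂ refl) rewrite at-w = ∸-monoˡ-≤ 1 (anti t)
      ... | no i≢t with i ≟ w
      ...   | yes refl = ≤-trans (f′≤f (suc w)) (≤-trans (≤-reflexive (vanish (suc w) ≤-refl)) z≤n)
      ...   | no i≢w rewrite elsewhere i≢t i≢w = ≤-trans (f′≤f (suc i)) (anti i)

      vanish′ : ∀ i → suc w ≤ i → f′ i ≡ 0
      vanish′ i w<i = n≤0⇒n≡0 (≤-trans (f′≤f i) (≤-reflexive (vanish i w<i)))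

      plateau : ∀ i → i ≤ t → f i ≡ suc (f t ∸ 1)
      plateau i i≤t = trans (trans (flat i i≤t) (≡.sym (flat t ≤-refl))) (≡.sym (m+[n∸m]≡n 1≤ft))

      total≡ : psum f (suc w) ≡ 2 + psum f′ (suc w)
      total≡ = psum-reduce f f′ t w (f t ∸ 1) t<w plateau 1≤fw f≡ even eg

      rec : Realization N f′
      rec = realize fuel (suc w) f′
              (≤-trans (≤-trans (n≤1+n _)
                 (≤-reflexive (trans (lem w (psum f′ (suc w))) (cong (w +_) (≡.sym total≡))))) bound)
              q≤N anti′ vanish′ (trans (cong odd (≡.sym total≡)) even)
              (reduce-EG f f′ t w (f t ∸ 1) t<w plateau 1≤fw f≡ even eg)
        where
        lem : ∀ w s → suc (suc w + s) ≡ w + (2 + s)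
        lem = solve-∀

      G = proj₁ rec
      degrees = proj₂ rec
      t<N : t < N
      t<N = ≤-trans t<w (<⇒≤ q≤N)
      t̂ = fromℕ< t<N
      ŵ = fromℕ< q≤N
      t̂≡ : toℕ t̂ ≡ t
      t̂≡ = toℕ-fromℕ< t<N
      ŵ≡ : toℕ ŵ ≡ w
      ŵ≡ = toℕ-fromℕ< q≤N

      t̂≢ŵ : t̂ ≢ ŵ
      t̂≢ŵ eq = <⇒≢ t<w (trans (≡.sym t̂≡) (trans (cong toℕ eq) ŵ≡))

      -- The inequality for k = 1 and m = w has an empty tail and reads `f 0` ≤ w; in G the degree
      -- of `t̂` is one less than `f t`, which equals `f 0`.
      room : 2 + degree G t̂ ≤ suc w
      room = s≤s (begin
        suc (degree G t̂)        ≡⟨ cong suc (trans (degrees t̂) (cong f′ t̂≡)) ⟩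
        suc (f′ t)               ≡⟨ +-comm 1 (f′ t) ⟩
        f′ t + 1                 ≡⟨ cong (f′ t +_) at-t ⟨
        f′ t + (δ t t + δ w t)   ≡⟨ f≡ t ⟨
        f t                      ≡⟨ flat t ≤-refl ⟩
        f 0                      ≤⟨ +-cancelʳ-≤ (psum f (suc w)) (f 0) (1 * w) (eg 1 w (s≤s z≤n) ≤-refl) ⟩
        1 * w                    ≡⟨ *-identityˡ w ⟩
        w                        ∎)
        where open ≤-Reasoning

      switch : adj G t̂ ŵ ≡ true → ∃ λ m → m ≢ t̂ × m ≢ ŵ × adj G t̂ m ≡ false × degree G ŵ ≤ degree G m
      switch tw with nonneighbour G (suc w) q≤N tw room
      ... | m , s≤s m≤w , m≢t , m≢w , tm = m , m≢t , m≢w , tm ,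
        subst₂ _≤_ (≡.sym (trans (degrees ŵ) (cong f′ ŵ≡))) (≡.sym (degrees m)) (antitone-≤ anti′ m≤w)

      raised = raise-degrees G t̂≢ŵ switch

  realizable : ∀ q f → q ≤ N → Antitone f → (∀ i → q ≤ i → f i ≡ 0) →
               odd (psum f q) ≡ false → EG f q → Realization N f
  realizable q f = realize (q + psum f q) q f ≤-refl

-- Handshake and necessity of the Erdős-Gallai inequalities

sum-map-swap : ∀ {A B : Set} (f : A → B → ℕ) xs ys →
  sum (map (λ x → sum (map (f x) ys)) xs) ≡ sum (map (λ y → sum (map (λ x → f x y) xs)) ys)
sum-map-swap f []       ys = ≡.sym (trans (sum-map-* 0 (λ _ → 0) ys) refl)
sum-map-swap f (x ∷ xs) ys = trans (cong (sum (map (f x) ys) +_) (sum-map-swap f xs ys))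
                                   (≡.sym (sum-map-+ (f x) _ ys))

sum-map-const : ∀ {A : Set} c (xs : List A) → sum (map (λ _ → c) xs) ≡ length xs * c
sum-map-const c []       = refl
sum-map-const c (x ∷ xs) = cong (c +_) (sum-map-const c xs)

sum-map-≤-∈ : ∀ {A : Set} {f g : A → ℕ} xs → (∀ {x} → x ∈ xs → f x ≤ g x) → sum (map f xs) ≤ sum (map g xs)
sum-map-≤-∈ []       f≤g = ≤-refl
sum-map-≤-∈ (x ∷ xs) f≤g = +-mono-≤ (f≤g (here refl)) (sum-map-≤-∈ xs (f≤g ∘ there))

sum-map-++ : ∀ {A : Set} (f : A → ℕ) xs ys → sum (map f (xs ++ ys)) ≡ sum (map f xs) + sum (map f ys)
sum-map-++ f xs ys = trans (cong sum (map-++ f xs ys)) (sum-++ (map f xs) (map f ys))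

handshake : ∀ {N} (G : SimpleGraph N) → sum (map (degree G) (allFin N)) ≡ edgeCount G + edgeCount G
handshake {N} G = begin
  ∑ (λ i → ∑ (λ j → bit (adj G i j)))
    ≡⟨ sum-map-cong (λ i → trans (sum-map-cong (split i) (allFin N)) (sum-map-+ (up i) _ (allFin N))) (allFin N) ⟩
  ∑ (λ i → ∑ (up i) + ∑ (λ j → up j i))
    ≡⟨ sum-map-+ (λ i → ∑ (up i)) _ (allFin N) ⟩
  edgeCount G + ∑ (λ i → ∑ (λ j → up j i))
    ≡⟨ cong (edgeCount G +_) (sum-map-swap (λ i j → up j i) (allFin N) (allFin N)) ⟩
  edgeCount G + edgeCount G ∎
  where
  open ≡-Reasoning
  up : Fin N → Fin N → ℕ
  up i j = bit (does (toℕ i <? toℕ j) ∧ adj G i j)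
  split : ∀ i j → bit (adj G i j) ≡ up i j + up j i
  split i j with <-cmp (toℕ i) (toℕ j)
  ... | tri< i<j _ j≮i rewrite dec-true (toℕ i <? toℕ j) i<j | dec-false (toℕ j <? toℕ i) j≮i = ≡.sym (+-identityʳ _)
  ... | tri> i≮j _ j<i rewrite dec-false (toℕ i <? toℕ j) i≮j | dec-true (toℕ j <? toℕ i) j<i = cong bit (sym G i j)
  ... | tri≈ i≮j i≡j j≮i rewrite dec-false (toℕ i <? toℕ j) i≮j | dec-false (toℕ j <? toℕ i) j≮i
        with toℕ-injective i≡j
  ...   | refl = cong bit (irrefl G i)

bit≤1 : ∀ b → bit b ≤ 1
bit≤1 true  = ≤-refl
bit≤1 false = z≤n

module _ {A : Set} (p : A → Bool) where

  count≤length : ∀ xs → sum (map (bit ∘ p) xs) ≤ length xs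
  count≤length []       = ≤-refl
  count≤length (x ∷ xs) = +-mono-≤ (bit≤1 (p x)) (count≤length xs)

  -- Used with x a vertex of the chosen set, which is not its own neighbour; this is the source of k
  -- - 1 in k (k - 1).
  count<length : ∀ {x xs} → x ∈ xs → p x ≡ false → sum (map (bit ∘ p) xs) ≤ length xs ∸ 1
  count<length {xs = y ∷ xs} (here refl) px rewrite px = count≤length xs
  count<length {xs = y ∷ z ∷ xs} (there x∈) px = +-mono-≤ (bit≤1 (p y)) (count<length x∈ px)

map≡++ : ∀ {A B : Set} (f : A → B) xs {ys} zs → xs ++ ys ≡ map f zs →
  ∃ λ us → ∃ λ vs → zs ≡ us ++ vs × xs ≡ map f us × ys ≡ map f vs
map≡++ f []       zs       eq = [] , zs , refl , refl , eq
map≡++ f (x ∷ xs) (z ∷ zs) eq with ∷-injective eq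
... | x≡ , eq′ with map≡++ f xs zs eq′
...   | us , vs , refl , refl , ys≡ = z ∷ us , vs , refl , cong (_∷ map f us) x≡ , ys≡

module _ {N : ℕ} (G : SimpleGraph N) where

  private
    e : Fin N → Fin N → ℕ
    e v u = bit (adj G v u)

  -- Count edge ends at A: inside A each vertex has at most |A| - 1, and a vertex u outside receives
  -- at most min {|A|, deg u}. `A` may be any set of vertices.
  vertex-bound : ∀ A B → allFin N ↭ A ++ B →
    sum (map (degree G) A) ≤ length A * (length A ∸ 1) + sum (map (λ u → length A ⊓ degree G u) B)
  vertex-bound A B perm = begin
    sum (map (degree G) A)
      ≡⟨ sum-map-cong degree-split A ⟩
    sum (map (λ v → sum (map (e v) A) + sum (map (e v) B)) A)
      ≡⟨ sum-map-+ (λ v → sum (map (e v) A)) _ A ⟩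
    sum (map (λ v → sum (map (e v) A)) A) + sum (map (λ v → sum (map (e v) B)) A)
      ≡⟨ cong (sum (map (λ v → sum (map (e v) A)) A) +_) (sum-map-swap e A B) ⟩
    sum (map (λ v → sum (map (e v) A)) A) + sum (map (λ u → sum (map (λ v → e v u) A)) B)
      ≤⟨ +-mono-≤ (sum-map-≤-∈ A (λ {v} v∈A → count<length (adj G v) v∈A (irrefl G v))) (sum-map-≤ outside B) ⟩
    sum (map (λ _ → length A ∸ 1) A) + sum (map (λ u → length A ⊓ degree G u) B)
      ≡⟨ cong (_+ sum (map (λ u → length A ⊓ degree G u) B)) (sum-map-const (length A ∸ 1) A) ⟩
    length A * (length A ∸ 1) + sum (map (λ u → length A ⊓ degree G u) B) ∎
    where
    open ≤-Reasoning
    degree-split : ∀ v → degree G v ≡ sum (map (e v) A) + sum (map (e v) B)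
    degree-split v = trans (sum-↭ (map⁺ (e v) perm)) (sum-map-++ (e v) A B)
    outside : ∀ u → sum (map (λ v → e v u) A) ≤ length A ⊓ degree G u
    outside u = ⊓-glb (count≤length (λ v → adj G v u) A)
      (subst₂ _≤_ (sum-map-cong (λ v → cong bit (sym G u v)) A) (≡.sym (degree-split u)) (m≤m+n _ _))

  degree-bound : ∀ xs ys → map (degree G) (allFin N) ↭ xs ++ ys →
    sum xs ≤ length xs * (length xs ∸ 1) + sum (map (length xs ⊓_) ys)
  degree-bound xs ys perm with ↭-map-inv (degree G) perm
  ... | vs , eq , perm′ with map≡++ (degree G) xs vs eq
  ...   | A , B , refl , refl , refl rewrite length-map (degree G) A | ≡.sym (map-∘ {g = length A ⊓_} {f = degree G} B) =
          vertex-bound A B perm′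

-- C⋆ as the least number of 2's

-- The k-th Erdős-Gallai inequality for `s` followed by c copies of 2, each contributing min {k,2},
-- written over the naturals: Δ + min {k,2} c ≥ 0.
Covers : List ℕ → ℕ → ℕ → Set
Covers s k c = sum (take k s) ≤ k * (k ∸ 1) + sum (map (k ⊓_) (drop k s)) + (k ⊓ 2) * c

module _ (s : List ℕ) (j c : ℕ) where

  private
    k = suc j
    m = k ⊓ 2
    X = k * j + sum (map (k ⊓_) (drop k s))
    Y = sum (take k s)
    -- Δ is negated twice because ceilDiv (- Δ) is itself a negated floor.
    q = (ℤ.- (ℤ.- Δ s k)) ℤ./ℕ m

    pos-X+mc : ℤ.+ (X + m * c) ≡ ℤ.+ X ℤ.+ ℤ.+ m ℤ.* ℤ.+ c
    pos-X+mc = trans (ℤ.pos-+ X (m * c)) (cong (ℤ._+_ (ℤ.+ X)) (ℤ.pos-* m c))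

  -- With the converse below, this is the adjunction between ceiling division and multiplication: ⌈
  -- x / m ⌉ ≤ c exactly when x ≤ m c, for x = -Δ.
  term≤⇒Covers : term s j ℤ.≤ ℤ.+ c → Covers s k c
  term≤⇒Covers h = ℤ.drop‿+≤+ (subst₂ ℤ._≤_ (lem₁ (ℤ.+ Y) (ℤ.+ c) (ℤ.+ m))
      (trans (lem₂ (ℤ.+ X) (ℤ.+ Y) (ℤ.+ c) (ℤ.+ m)) (≡.sym pos-X+mc))
      (ℤ.+-monoˡ-≤ (ℤ.+ Y ℤ.+ ℤ.+ m ℤ.* ℤ.+ c) bound))
    where
    bound : (ℤ.- ℤ.+ c) ℤ.* ℤ.+ m ℤ.≤ Δ s k
    bound = ℤ.≤-trans
      (ℤ.*-monoʳ-≤-nonNeg (ℤ.+ m) (subst (ℤ._≤_ (ℤ.- ℤ.+ c)) (ℤ.neg-involutive q) (ℤ.neg-mono-≤ h)))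
      (subst (ℤ._≤_ (q ℤ.* ℤ.+ m)) (ℤ.neg-involutive (Δ s k)) (ℤ.[n/ℕd]*d≤n (ℤ.- (ℤ.- Δ s k)) m))
    lem₁ : ∀ Y c m → ((ℤ.- c) ℤ.* m) ℤ.+ (Y ℤ.+ m ℤ.* c) ≡ Y
    lem₁ = ℤSolver.solve-∀
    lem₂ : ∀ X Y c m → (X ℤ.- Y) ℤ.+ (Y ℤ.+ m ℤ.* c) ≡ X ℤ.+ m ℤ.* c
    lem₂ = ℤSolver.solve-∀

  Covers⇒term≤ : Covers s k c → term s j ℤ.≤ ℤ.+ c
  Covers⇒term≤ cov with (ℤ.- ℤ.+ c) ℤ.≤? q
  ... | yes -c≤q = subst (ℤ._≤_ (ℤ.- q)) (ℤ.neg-involutive (ℤ.+ c)) (ℤ.neg-mono-≤ -c≤q)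
  -- Here q + 1 ≤ -c, hence (q + 1) m ≤ Δ, although q is the floor of Δ / m.
  ... | no  -c≰q = contradiction
          (ℤ.≤-trans (ℤ.*-monoʳ-≤-nonNeg (ℤ.+ m) (ℤ.i<j⇒suc[i]≤j (ℤ.≰⇒> -c≰q))) bound)
          (ℤ.<⇒≱ (ℤ.n<s[n/ℕd]*d (ℤ.- (ℤ.- Δ s k)) m))
    where
    lem₁ : ∀ Y c m → Y ℤ.+ (ℤ.- (Y ℤ.+ m ℤ.* c)) ≡ (ℤ.- c) ℤ.* m
    lem₁ = ℤSolver.solve-∀
    lem₂ : ∀ X Y c m → (X ℤ.+ m ℤ.* c) ℤ.+ (ℤ.- (Y ℤ.+ m ℤ.* c)) ≡ X ℤ.- Y
    lem₂ = ℤSolver.solve-∀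
    bound : (ℤ.- ℤ.+ c) ℤ.* ℤ.+ m ℤ.≤ ℤ.- (ℤ.- Δ s k)
    bound = subst₂ ℤ._≤_ (lem₁ (ℤ.+ Y) (ℤ.+ c) (ℤ.+ m))
      (trans (cong (ℤ._+ (ℤ.- (ℤ.+ Y ℤ.+ ℤ.+ m ℤ.* ℤ.+ c))) pos-X+mc)
        (trans (lem₂ (ℤ.+ X) (ℤ.+ Y) (ℤ.+ c) (ℤ.+ m)) (≡.sym (ℤ.neg-involutive (Δ s k)))))
      (ℤ.+-monoˡ-≤ (ℤ.- (ℤ.+ Y ℤ.+ ℤ.+ m ℤ.* ℤ.+ c)) (ℤ.+≤+ cov))

maxTerm≤⇒Covers : ∀ s m c → maxTerm s m ℤ.≤ ℤ.+ c → ∀ j → j ≤ m → Covers s (suc j) c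
maxTerm≤⇒Covers s zero    c h zero z≤n = term≤⇒Covers s 0 c h
maxTerm≤⇒Covers s (suc m) c h j j≤sm with m≤n⇒m<n∨m≡n j≤sm
... | inj₁ (s≤s j≤m) = maxTerm≤⇒Covers s m c (ℤ.i⊔j≤k⇒i≤k (maxTerm s m) (term s (suc m)) h) j j≤m
... | inj₂ refl      = term≤⇒Covers s j c (ℤ.i⊔j≤k⇒j≤k (maxTerm s m) (term s (suc m)) h)

Covers⇒maxTerm≤ : ∀ s m c → (∀ j → j ≤ m → Covers s (suc j) c) → maxTerm s m ℤ.≤ ℤ.+ c
Covers⇒maxTerm≤ s zero    c cov = Covers⇒term≤ s 0 c (cov 0 z≤n)
Covers⇒maxTerm≤ s (suc m) c cov = ℤ.⊔-lub (Covers⇒maxTerm≤ s m c (λ j j≤m → cov j (m≤n⇒m≤1+n j≤m)))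
                                           (Covers⇒term≤ s (suc m) c (cov (suc m) ≤-refl))

-- A negative maximum would make c = 0 admissible, contradicting the inequality at k = 1.
maxTerm-natural : ∀ x xs m → length xs < x → ∃ λ c → maxTerm (x ∷ xs) m ≡ ℤ.+ c
maxTerm-natural x xs m big with maxTerm (x ∷ xs) m in eq
... | ℤ.+ c    = c , refl
... | -[1+ n ] = contradiction (maxTerm≤⇒Covers (x ∷ xs) m 0 (subst (ℤ._≤ ℤ.+ 0) (≡.sym eq) ℤ.-≤+) 0 z≤n)
                   (<⇒≱ (begin-strict
      sum (map (1 ⊓_) xs) + 0 ≡⟨ +-identityʳ _ ⟩
      sum (map (1 ⊓_) xs)     ≤⟨ sum-map-≤ (m⊓n≤m 1) xs ⟩
      sum (map (λ _ → 1) xs)  ≡⟨ trans (sum-map-const 1 xs) (*-identityʳ (length xs)) ⟩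
      length xs               <⟨ big ⟩
      x                       ≡⟨ +-identityʳ x ⟨
      x + 0                   ∎))
  where open ≤-Reasoning

-- Upper bound: padding with 2's

-- The default 0 past the end is the vanishing that `realizable` demands.
get : List ℕ → ℕ → ℕ
get []       _       = 0
get (x ∷ xs) zero    = x
get (x ∷ xs) (suc i) = get xs i

get-lookup : ∀ xs i → get xs (toℕ i) ≡ lookup xs i
get-lookup (x ∷ xs) Fin.zero    = refl
get-lookup (x ∷ xs) (Fin.suc i) = get-lookup xs i

get-beyond : ∀ xs i → length xs ≤ i → get xs i ≡ 0
get-beyond []       i       _         = refl
get-beyond (x ∷ xs) (suc i) (s≤s n≤i) = get-beyond xs i n≤i

psum-get : ∀ xs k → psum (get xs) k ≡ sum (take k xs)
psum-get xs       zero    = refl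
psum-get []       (suc k) = trans (psum-const 0 (suc k)) (*-zeroʳ k)
psum-get (x ∷ xs) (suc k) = trans (psum-front (get (x ∷ xs)) k) (cong (x +_) (psum-get xs k))

psum-get-all : ∀ xs → psum (get xs) (length xs) ≡ sum xs
psum-get-all xs = trans (psum-get xs (length xs)) (cong sum (take-all (length xs) xs ≤-refl))

take-++-≤ : ∀ k (xs ys : List ℕ) → k ≤ length xs → take k (xs ++ ys) ≡ take k xs
take-++-≤ zero    xs       ys _         = refl
take-++-≤ (suc k) (x ∷ xs) ys (s≤s k≤) = cong (x ∷_) (take-++-≤ k xs ys k≤)

drop-++-≤ : ∀ k (xs ys : List ℕ) → k ≤ length xs → drop k (xs ++ ys) ≡ drop k xs ++ ys
drop-++-≤ zero    xs       ys _         = refl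
drop-++-≤ (suc k) (x ∷ xs) ys (s≤s k≤) = drop-++-≤ k xs ys k≤

take-+ : ∀ k j (xs : List ℕ) → sum (take (k + j) xs) ≡ sum (take k xs) + sum (take j (drop k xs))
take-+ zero    j xs       = refl
take-+ (suc k) zero    [] = refl
take-+ (suc k) (suc j) [] = refl
take-+ (suc k) j (x ∷ xs) = trans (cong (x +_) (take-+ k j xs)) (≡.sym (+-assoc x _ _))

sum-take+drop : ∀ k (xs : List ℕ) → sum (take k xs) + sum (drop k xs) ≡ sum xs
sum-take+drop k xs = trans (≡.sym (sum-++ (take k xs) (drop k xs))) (cong sum (take++drop≡id k xs))

sum-replicate : ∀ c d → sum (replicate c d) ≡ c * d
sum-replicate zero    d = refl
sum-replicate (suc c) d = cong (d +_) (sum-replicate c d)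

-- The passage from `Covers` to `EG`: min {k , x} is at most k on the first j entries and at most x
-- afterwards.
linearise-⊓ : ∀ k j xs → sum (take j xs) + sum (map (k ⊓_) xs) ≤ j * k + sum xs
linearise-⊓ k zero    xs       = ≤-trans (sum-map-≤ (m⊓n≤n k) xs) (≤-reflexive (cong sum (map-id xs)))
linearise-⊓ k (suc j) []       = z≤n
linearise-⊓ k (suc j) (x ∷ xs) = ≤-from 0 (+-mono-≤ (m⊓n≤m k x) (linearise-⊓ k j xs))
  (lem x k (k ⊓ x) (sum (take j xs)) (sum (map (k ⊓_) xs)) (j * k) (sum xs))
  where
  lem : ∀ x k kx a b jk c → x + a + (kx + b) + (k + (jk + c)) + 0 ≡ k + jk + (x + c) + (kx + (a + b))
  lem = solve-∀

-- `suc K` is one less than the length of `s`, hence the largest k for which `cov` speaks; `big`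
-- says that the first entry exceeds the number of the others.
module Padding (s : List ℕ) (c K x : ℕ) (xs : List ℕ) (s≡ : s ≡ x ∷ xs) (len : length xs ≡ suc K)
               (sorted : AllPairs _≥_ s) (s≥2 : All (2 ≤_) s) (2∈s : 2 ∈ s) (big : suc K < x)
               (even : odd (sum s) ≡ false) (cov : ∀ j → j ≤ K → Covers s (suc j) c) where

  t : List ℕ
  t = s ++ replicate c 2

  private
    f = get t
    q = length t

  length-s : length s ≡ suc (suc K)
  length-s = trans (cong length s≡) (cong suc len)

  length-t : q ≡ suc (suc K) + c
  length-t = trans (length-++ s) (cong₂ _+_ length-s (length-replicate c))

  sum-t : sum t ≡ sum s + (c + c)
  sum-t = trans (sum-++ s (replicate c 2)) (cong (sum s +_) (trans (sum-replicate c 2) (lem c)))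
    where
    lem : ∀ c → c * 2 ≡ c + c
    lem = solve-∀

  get-twos : ∀ c i → get (replicate c 2) i ≤ 2
  get-twos zero    i       = z≤n
  get-twos (suc c) zero    = ≤-refl
  get-twos (suc c) (suc i) = get-twos c i

  private
    antitone : ∀ s → AllPairs _≥_ s → All (2 ≤_) s → Antitone (get (s ++ replicate c 2))
    antitone [] _ _ i = twos c i
      where
      twos : ∀ c → Antitone (get (replicate c 2))
      twos zero    i       = z≤n
      twos (suc c) zero    = get-twos c 0
      twos (suc c) (suc i) = twos c i
    antitone (x ∷ [])     _         (2≤x ∷ _)   zero = ≤-trans (get-twos c 0) 2≤x
    antitone (x ∷ y ∷ xs) ((x≥y ∷ _) ∷ _) _     zero = x≥y
    antitone (x ∷ xs) (_ ∷ sorted) (_ ∷ xs≥2) (suc i) = antitone xs sorted xs≥2 i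

    -- `length s ≤ suc i` lets i start at the last index of `s`, not one past it; the entry there is
    -- 2 because 2 occurs in `s` and nothing smaller does.
    tail≤2 : ∀ s → AllPairs _≥_ s → All (2 ≤_) s → 2 ∈ s → ∀ i → length s ≤ suc i → get (s ++ replicate c 2) i ≤ 2
    tail≤2 (x ∷ xs) sorted all≥2 (here refl) i _ = antitone-≤ (antitone (2 ∷ xs) sorted all≥2) {j = i} z≤n
    tail≤2 (x ∷ y ∷ xs) (_ ∷ sorted) (_ ∷ all≥2) (there 2∈) (suc i) (s≤s len≤) = tail≤2 (y ∷ xs) sorted all≥2 2∈ i len≤

    EG-start : ∀ k m → k ≤ suc K → k ≤ suc m → m < q → psum f k + psum f (suc m) ≤ k * m + psum f q
    EG-start zero    m _ _ m<q = psum-mono f m<q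
    EG-start (suc j) m (s≤s j≤K) (s≤s j≤m) m<q with m≤n⇒∃[o]m+o≡n j≤m
    ... | o , refl rewrite psum-get t (suc j) | psum-get t (suc j + o) | psum-get-all t
                         | take-+ (suc j) o t | ≡.sym (sum-take+drop (suc j) t) =
          ≤-from 0 (+-mono-≤ cov-t (linearise-⊓ (suc j) o (drop (suc j) t)))
            (lem j o (sum (take (suc j) t)) (sum (take o (drop (suc j) t)))
              (sum (drop (suc j) t)) (sum (map (suc j ⊓_) (drop (suc j) t))))
      where
      k≤s : suc j ≤ length s
      k≤s = subst (suc j ≤_) (≡.sym length-s) (s≤s (m≤n⇒m≤1+n j≤K))
      cov-t : sum (take (suc j) t) ≤ suc j * j + sum (map (suc j ⊓_) (drop (suc j) t))
      cov-t rewrite take-++-≤ (suc j) s (replicate c 2) k≤s | drop-++-≤ (suc j) s (replicate c 2) k≤s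
        | sum-map-++ (suc j ⊓_) (drop (suc j) s) (replicate c 2) | map-replicate (suc j ⊓_) c 2
        | sum-replicate c (suc j ⊓ 2) | *-comm c (suc j ⊓ 2)
        | ≡.sym (+-assoc (suc j * j) (sum (map (suc j ⊓_) (drop (suc j) s))) ((suc j ⊓ 2) * c)) = cov j j≤K
      lem : ∀ j o A B C M → A + (A + B) + (suc j * j + M + (o * suc j + C)) + 0
                            ≡ suc j * (j + o) + (A + C) + (A + (B + M))
      lem = solve-∀

    x≡f0 : f 0 ≡ x
    x≡f0 = cong (λ s → get (s ++ replicate c 2) 0) s≡

    -- The case k = 1 with m the last index, where the tail is empty: the first degree is less than
    -- the number of vertices.
    x≤K+c : x ≤ suc K + c
    x≤K+c = subst₂ _≤_ x≡f0 (*-identityˡ (suc K + c)) (+-cancelʳ-≤ (psum f q) (f 0) (1 * (suc K + c))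
      (subst (λ n → f 0 + psum f n ≤ 1 * (suc K + c) + psum f q) (≡.sym length-t)
         (EG-start 1 (suc K + c) (s≤s z≤n) (s≤s z≤n) (≤-reflexive (≡.sym length-t)))))

    1≤c : 1 ≤ c
    1≤c = +-cancelˡ-≤ (suc K) 1 c (≤-trans (≤-reflexive (+-comm (suc K) 1)) (≤-trans big x≤K+c))

    -- The last entry of s is 2, so from there on each further entry costs at most 2 ≤ m.
    EG-all : ∀ k m → k ≤ suc m → m < q → psum f k + psum f (suc m) ≤ k * m + psum f q
    EG-all k m k≤sm m<q with k ≤? suc K
    ... | yes k≤ = EG-start k m k≤ k≤sm m<q
    EG-all zero    m             k≤sm m<q | no k≰ = contradiction z≤n k≰
    EG-all (suc zero)    m    k≤sm m<q | no k≰ = contradiction (s≤s z≤n) k≰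
    EG-all (suc (suc k)) zero          (s≤s ()) m<q | no k≰
    -- The step by 2 ≤ m breaks down at m = 1, which forces k = 2 and two entries in `s`. The claim
    -- x + `f 1` ≤ 2 + 2c then follows from `f 1` ≤ 2, x ≤ 1 + c and 1 ≤ c.
    EG-all (suc (suc zero)) (suc zero) k≤sm m<q | no k≰ =
      ≤-from 0 (+-mono-≤ (+-mono-≤ f1≤2 x≤1+c) 1≤c)
        (trans (cong (λ a → a + a + (2 + suc c + c) + 0) psum-2)
               (trans (lem x (f 1) c) (cong (λ a → 2 + a + (f 1 + x + 1)) (≡.sym psum-q))))
      where
      len-2 : length s ≡ 2
      len-2 = trans length-s (cong (λ n → suc (suc n)) (n<1⇒n≡0 (≤-pred (≰⇒> k≰))))
      x≤1+c : x ≤ suc c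
      x≤1+c = subst (λ n → x ≤ suc n + c) (n<1⇒n≡0 (≤-pred (≰⇒> k≰))) x≤K+c
      f1≤2 : f 1 ≤ 2
      f1≤2 = tail≤2 s sorted s≥2 2∈s 1 (≤-reflexive len-2)
      psum-2 : psum f 2 ≡ x + f 1
      psum-2 = cong (_+ f 1) x≡f0
      psum-q : psum f q ≡ x + f 1 + (c + c)
      psum-q = trans (psum-get-all t) (trans sum-t (cong (_+ (c + c)) (trans
        (cong sum (trans (≡.sym (take-all (length s) s ≤-refl))
          (trans (≡.sym (take-++-≤ (length s) s (replicate c 2) ≤-refl)) (cong (λ n → take n t) len-2))))
        (trans (≡.sym (psum-get t 2)) psum-2))))
      lem : ∀ x y c → x + y + (x + y) + (2 + suc c + c) + 0 ≡ 2 + (x + y + (c + c)) + (y + x + 1)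
      lem = solve-∀
    EG-all (suc (suc (suc k))) (suc zero) (s≤s (s≤s ())) m<q | no k≰
    EG-all (suc k@(suc _)) m@(suc (suc n)) k≤sm m<q | no k≰ =
      ≤-from n (+-mono-≤ (EG-all k m (<⇒≤ k≤sm) m<q)
        (tail≤2 s sorted s≥2 2∈s k (subst (_≤ suc k) (≡.sym length-s) (≰⇒> k≰))))
        (lem (psum f k) (f k) (psum f (suc m)) (k * m) n (psum f q))
      where
      lem : ∀ A b S km n Q → A + b + S + (km + Q + 2) + n ≡ (suc (suc n) + km) + Q + (A + S + b)
      lem = solve-∀

  realization : Realization q f
  realization = realizable q q f ≤-refl (antitone s sorted s≥2) (get-beyond t)
    (trans (cong odd (trans (psum-get-all t) sum-t))
           (trans (odd-+ (sum s) (c + c)) (cong₂ _xor_ even (odd-double c))))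
    EG-all

  padded-graph : ∃ λ N → Σ (SimpleGraph N) λ G → (∀ i → degree G i ∈ s) × (∀ d → d ∈ s → ∃ λ i → degree G i ≡ d)
                 × edgeCount G + edgeCount G ≡ sum s + (c + c)
  padded-graph = q , G , member , attained , edges
    where
    G = proj₁ realization
    deg : ∀ i → degree G i ≡ lookup t i
    deg i = trans (proj₂ realization i) (get-lookup t i)
    twos : ∀ c {d} → d ∈ replicate c 2 → d ≡ 2
    twos (suc c) (here refl) = refl
    twos (suc c) (there d∈)  = twos c d∈
    t⊆s : ∀ {d} → d ∈ t → d ∈ s
    t⊆s d∈t with ∈-++⁻ s d∈t
    ... | inj₁ d∈s = d∈s
    ... | inj₂ d∈twos rewrite twos c d∈twos = 2∈s
    member : ∀ i → degree G i ∈ s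
    member i = subst (_∈ s) (≡.sym (deg i)) (t⊆s (∈-lookup i))
    attained : ∀ d → d ∈ s → ∃ λ i → degree G i ≡ d
    attained d d∈s = index d∈t , trans (deg (index d∈t)) (≡.sym (lookup-index d∈t))
      where
      d∈t : d ∈ t
      d∈t = ∈-++⁺ˡ d∈s
    edges : edgeCount G + edgeCount G ≡ sum s + (c + c)
    edges = trans (≡.sym (handshake G)) (trans (sum-map-cong (proj₂ realization) (allFin q))
              (trans (∑-toℕ q f) (trans (psum-get-all t) sum-t)))

-- Lower bound: the extra degrees

∈⇒↭ : ∀ {x} {xs : List ℕ} → x ∈ xs → ∃ λ ys → xs ↭ x ∷ ys
∈⇒↭ {x} x∈xs with ∈-∃++ x∈xs
... | as , bs , refl = as ++ bs , shift x as bs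

extract : ∀ {D L : List ℕ} → Unique D → (∀ {d} → d ∈ D → d ∈ L) → ∃ λ E → L ↭ D ++ E
extract {[]}    {L} []           D⊆L = L , ↭-refl
extract {x ∷ D} {L} (x∉D ∷ uniq) D⊆L with ∈⇒↭ (D⊆L (here refl))
... | L′ , L↭ with extract {D} {L′} uniq D⊆L′
  where
  D⊆L′ : ∀ {d} → d ∈ D → d ∈ L′
  D⊆L′ d∈D with ∈-resp-↭ L↭ (D⊆L (there d∈D))
  ... | here refl = contradiction refl (All.lookup x∉D d∈D)
  ... | there d∈  = d∈
...   | E , perm = E , ↭-trans L↭ (prep x perm)

m+m≤n+n⇒m≤n : ∀ {m n} → m + m ≤ n + n → m ≤ n
m+m≤n+n⇒m≤n {m} {n} h with m ≤? n
... | yes m≤n = m≤n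
... | no m≰n  = contradiction h (<⇒≱ (+-mono-< (≰⇒> m≰n) (≰⇒> m≰n)))

sum-⊓-≤ : ∀ k xs → sum (map (k ⊓_) xs) ≤ sum xs
sum-⊓-≤ k []       = ≤-refl
sum-⊓-≤ k (x ∷ xs) = +-mono-≤ (m⊓n≤n k x) (sum-⊓-≤ k xs)

length≤half : ∀ {E h} → All (2 ≤_) E → sum E ≤ h + h → length E ≤ h
length≤half {E} E≥2 bound = m+m≤n+n⇒m≤n (≤-trans (double E E≥2) bound)
  where
  double : ∀ E → All (2 ≤_) E → length E + length E ≤ sum E
  double []      []            = z≤n
  double (e ∷ E) (2≤e ∷ E≥2) =
    subst (_≤ e + sum E) (cong suc (≡.sym (+-suc (length E) (length E)))) (+-mono-≤ 2≤e (double E E≥2))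

-- For k = 1 both leading minima are 1 and E has at most h entries, each being at least 2. For k ≥
-- 2, min {k , r + d} ≤ min {k , r} + d, and d together with the sum of E is 2h.
extras-bound : ∀ j r d h {E} → All (2 ≤_) E → 1 ≤ r → d + sum E ≡ h + h →
  (suc j ⊓ (r + d)) + sum (map (suc j ⊓_) E) ≤ (suc j ⊓ r) + (suc j ⊓ 2) * h
extras-bound zero (suc r) d h {E} E≥2 _ total = s≤s (begin
  sum (map (1 ⊓_) E)       ≤⟨ sum-map-≤ (m⊓n≤m 1) E ⟩
  sum (map (λ _ → 1) E)    ≡⟨ trans (sum-map-const 1 E) (*-identityʳ (length E)) ⟩
  length E                 ≤⟨ length≤half E≥2 (≤-trans (m≤n+m (sum E) d) (≤-reflexive total)) ⟩
  h                        ≡⟨ +-identityʳ h ⟨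
  1 * h                    ∎)
  where open ≤-Reasoning
extras-bound (suc j) r d h {E} E≥2 _ total = begin
  (k ⊓ (r + d)) + sum (map (k ⊓_) E)  ≤⟨ +-mono-≤ (⊓-monoˡ-≤ (r + d) (m≤m+n k d)) (sum-⊓-≤ k E) ⟩
  ((k + d) ⊓ (r + d)) + sum E         ≡⟨ cong (_+ sum E) (+-distribʳ-⊓ d k r) ⟨
  (k ⊓ r) + d + sum E                 ≡⟨ +-assoc (k ⊓ r) d (sum E) ⟩
  (k ⊓ r) + (d + sum E)               ≡⟨ cong ((k ⊓ r) +_) total ⟩
  (k ⊓ r) + (h + h)                   ≡⟨ cong ((k ⊓ r) +_) (lem h) ⟩
  (k ⊓ r) + 2 * h                     ≡⟨ cong (λ n → (k ⊓ r) + suc (suc n) * h) (⊓-zeroʳ j) ⟨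
  (k ⊓ r) + (k ⊓ 2) * h               ∎
  where
  open ≤-Reasoning
  k = suc (suc j)
  lem : ∀ h → h + h ≡ 2 * h
  lem = solve-∀

length-take-≤ : ∀ k (xs : List ℕ) → k ≤ length xs → length (take k xs) ≡ k
length-take-≤ k xs k≤ = trans (length-take k xs) (m≤n⇒m⊓n≡m k≤)

xor-cancel : ∀ a {b} → a xor b ≡ false → b ≡ a
xor-cancel true  {true}  _ = refl
xor-cancel false {false} _ = refl

odd-member : ∀ xs → odd (sum xs) ≡ true → ∃ λ x → x ∈ xs × odd x ≡ true
odd-member (x ∷ xs) odd-sum with odd x in ox
... | true  = x , here refl , ox
... | false with odd-member xs (trans (≡.sym (trans (odd-+ x (sum xs)) (cong (_xor odd (sum xs)) ox))) odd-sum)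
...   | y , y∈ , oy = y , there y∈ , oy

any-odd : ∀ {x xs} → x ∈ xs → odd x ≡ true → any odd xs ≡ true
any-odd {xs = y ∷ xs} (here refl) ox rewrite ox = refl
any-odd {xs = y ∷ xs} (there x∈)  ox rewrite any-odd x∈ ox = ∨-zeroʳ (odd y)

record LastOdd (D : List ℕ) : Set where
  field
    A B        : List ℕ
    r          : ℕ
    D≡         : D ≡ A ++ r ∷ B
    dup≡       : dupLastOdd D ≡ A ++ r ∷ r ∷ B
    lastOdd≡   : lastOdd D ≡ r
    r-odd      : odd r ≡ true
    B-even     : any odd B ≡ false

last-odd : ∀ D → any odd D ≡ true → LastOdd D
last-odd (x ∷ xs) h with any odd xs in rest
... | true  = record
  { A = x ∷ A ; B = B ; r = r ; r-odd = r-odd ; B-even = B-even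
  ; D≡       = cong (x ∷_) D≡
  ; dup≡     = trans (cong (if_then x ∷ dupLastOdd xs else (if odd x then x ∷ x ∷ xs else x ∷ xs)) rest) (cong (x ∷_) dup≡)
  ; lastOdd≡ = trans (cong (if_then lastOdd xs else (if odd x then x else 0)) rest) lastOdd≡
  }
  where open LastOdd (last-odd xs rest)
... | false with odd x in ox
...   | true = record
  { A = [] ; B = xs ; r = x ; r-odd = ox ; B-even = rest
  ; D≡       = refl
  ; dup≡     = cong₂ (λ b c → if b then x ∷ dupLastOdd xs else (if c then x ∷ x ∷ xs else x ∷ xs)) rest ox
  ; lastOdd≡ = cong₂ (λ b c → if b then lastOdd xs else (if c then x else 0)) rest ox
  }

before-> : ∀ A {r B e} → AllPairs _>_ (A ++ r ∷ B) → e ∈ A → r < e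
before-> (x ∷ A) (x> ∷ _)    (here refl) = All.lookup x> (∈-insert A)
before-> (x ∷ A) (_ ∷ decr) (there e∈)  = before-> A decr e∈

odd≥r : ∀ A {r B e} → AllPairs _>_ (A ++ r ∷ B) → any odd B ≡ false → e ∈ A ++ r ∷ B → odd e ≡ true → r ≤ e
odd≥r A decr B-even e∈ oe with ∈-++⁻ A e∈
... | inj₁ e∈A         = <⇒≤ (before-> A decr e∈A)
... | inj₂ (here refl) = ≤-refl
... | inj₂ (there e∈B) = contradiction (trans (≡.sym B-even) (any-odd e∈B oe)) λ ()

-- Distinguishes on which side of the cut at k the second copy of r falls; removing it leaves a cut
-- of D at k, respectively at k - 1.
dup-split : ∀ (A : List ℕ) r B k →
  (take k (A ++ r ∷ r ∷ B) ≡ take k (A ++ r ∷ B) × drop k (A ++ r ∷ r ∷ B) ↭ r ∷ drop k (A ++ r ∷ B)) ⊎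
  (∃ λ l → k ≡ suc (suc l) × take k (A ++ r ∷ r ∷ B) ↭ r ∷ take (suc l) (A ++ r ∷ B)
           × drop k (A ++ r ∷ r ∷ B) ≡ drop (suc l) (A ++ r ∷ B))
dup-split A       r B zero          = inj₁ (refl , shift r A (r ∷ B))
dup-split []      r B (suc zero)    = inj₁ (refl , ↭-refl)
dup-split []      r B (suc (suc k)) = inj₂ (k , refl , ↭-refl , refl)
dup-split (x ∷ A) r B (suc k) with dup-split A r B k
... | inj₁ (p , q)                = inj₁ (cong (x ∷_) p , q)
... | inj₂ (l , refl , p , q)     = inj₂ (suc l , refl , ↭-trans (prep x p) (swap x r ↭-refl) , q)

module _ {N : ℕ} (G : SimpleGraph N) {D : List ℕ} (decr : AllPairs _>_ D) (D≥2 : All (2 ≤_) D)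
         (degs : HasDegreeSet G D) where

  private
    L = map (degree G) (allFin N)

    L⊆D : ∀ {d} → d ∈ L → d ∈ D
    L⊆D d∈L with ∈-map⁻ (degree G) d∈L
    ... | i , _ , refl = proj₁ degs i

    D⊆L : ∀ {d} → d ∈ D → d ∈ L
    D⊆L {d} d∈D with proj₂ degs d d∈D
    ... | i , refl = ∈-map⁺ (degree G) (∈-allFin i)

  extras : ∃ λ E → L ↭ D ++ E
  extras = extract (AllPairs.map >⇒≢ decr) D⊆L

  private
    E = proj₁ extras
    perm = proj₂ extras

    E⊆D : ∀ {e} → e ∈ E → e ∈ D
    E⊆D e∈E = L⊆D (∈-resp-↭ (↭-sym perm) (∈-++⁺ʳ D e∈E))

    total : edgeCount G + edgeCount G ≡ sum D + sum E
    total = trans (≡.sym (handshake G)) (trans (sum-↭ perm) (sum-++ D E))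

    parity : odd (sum E) ≡ odd (sum D)
    parity = xor-cancel (odd (sum D)) (trans (≡.sym (odd-+ (sum D) (sum E)))
               (trans (cong odd (≡.sym total)) (odd-double (edgeCount G))))

    perm-at : ∀ k → L ↭ take k D ++ (drop k D ++ E)
    perm-at k = ↭-trans perm (↭-reflexive (trans (cong (_++ E) (≡.sym (take++drop≡id k D)))
                  (++-assoc (take k D) (drop k D) E)))

    bound-at : ∀ k xs ys zs → L ↭ xs ++ (ys ++ zs) → length xs ≡ k →
      sum xs ≤ k * (k ∸ 1) + sum (map (k ⊓_) ys) + sum (map (k ⊓_) zs)
    bound-at k xs ys zs p refl = ≤-trans (degree-bound G xs (ys ++ zs) p) (≤-reflexive
      (trans (cong (k * (k ∸ 1) +_) (sum-map-++ (k ⊓_) ys zs)) (≡.sym (+-assoc (k * (k ∸ 1)) _ _))))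

  even-lower : odd (σ D) ≡ false →
    ∃ λ h → edgeCount G + edgeCount G ≡ σ D + (h + h) × (∀ j → j < length D → Covers D (suc j) h)
  even-lower even with half (sum E) (trans parity even)
  ... | h , sumE = h , trans total (cong (sum D +_) sumE) , covers
    where
    covers : ∀ j → j < length D → Covers D (suc j) h
    covers j j<n = ≤-trans
      (bound-at (suc j) (take (suc j) D) (drop (suc j) D) E (perm-at (suc j)) (length-take-≤ (suc j) D j<n))
      -- No degree is singled out here, so the dummy values r = 1, d = 0 put the same min {k,1} on
      -- both sides, and it cancels.
      (+-monoʳ-≤ _ (+-cancelˡ-≤ (suc j ⊓ 1) _ _ (extras-bound j 1 0 h (All.tabulate (All.lookup D≥2 ∘ E⊆D)) ≤-refl sumE)))

  -- Some extra degree e is odd, and e ≥ d_r; it plays the role of the second copy of d_r.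
  odd-lower : odd (σ D) ≡ true → (lo : LastOdd D) → let open LastOdd lo in
    ∃ λ h → edgeCount G + edgeCount G ≡ σ D + r + (h + h) × (∀ j → j < length D → Covers (A ++ r ∷ r ∷ B) (suc j) h)
  odd-lower odd-σ record { A = A ; B = B ; r = r ; D≡ = refl ; r-odd = r-odd ; B-even = B-even }
    with odd-member E (trans parity odd-σ)
  ... | e , e∈E , e-odd with m≤n⇒∃[o]m+o≡n (odd≥r A decr B-even (E⊆D e∈E) e-odd)
  ...   | d , refl with ∈⇒↭ e∈E
  ...     | E′ , E↭ with half (d + sum E′) (odd-+-cancel r r-odd
                           (trans (cong odd (trans (≡.sym (+-assoc r d (sum E′))) (≡.sym (sum-↭ E↭)))) (trans parity odd-σ)))
  ...       | h , excess = h , edges , covers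
    where
    E′≥2 : All (2 ≤_) E′
    E′≥2 = All.tabulate (λ x∈ → All.lookup D≥2 (E⊆D (∈-resp-↭ (↭-sym E↭) (there x∈))))
    1≤r : 1 ≤ r
    1≤r = ≤-trans (s≤s z≤n) (All.lookup D≥2 (∈-insert A))
    edges : edgeCount G + edgeCount G ≡ sum D + r + (h + h)
    edges = trans total (trans (cong (sum D +_) (trans (sum-↭ E↭) (trans (+-assoc r d (sum E′)) (cong (r +_) excess))))
                               (≡.sym (+-assoc (sum D) r (h + h))))
    s = A ++ r ∷ r ∷ B
    covers : ∀ j → j < length D → Covers s (suc j) h
    covers j j<n with dup-split A r B (suc j)
    -- The second copy lies in the tail: e = r + d takes its place there, and its surplus d counts
    -- towards 2h.
    ... | inj₁ (take≡ , drop↭) = begin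
            sum (take k s)
              ≡⟨ cong sum take≡ ⟩
            sum (take k D)
              ≤⟨ bound-at k (take k D) (drop k D) ((r + d) ∷ E′)
                   (↭-trans (perm-at k) (++⁺ˡ (take k D) (++⁺ˡ (drop k D) E↭))) (length-take-≤ k D j<n) ⟩
            k * j + M + ((k ⊓ (r + d)) + sum (map (k ⊓_) E′))
              ≤⟨ +-monoʳ-≤ (k * j + M) (extras-bound j r d h E′≥2 1≤r excess) ⟩
            k * j + M + ((k ⊓ r) + (k ⊓ 2) * h)
              ≡⟨ lem (k * j) M (k ⊓ r) ((k ⊓ 2) * h) ⟩
            k * j + ((k ⊓ r) + M) + (k ⊓ 2) * h
              ≡⟨ cong (λ x → k * j + x + (k ⊓ 2) * h) (sum-↭ (map⁺ (k ⊓_) drop↭)) ⟨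
            k * j + sum (map (k ⊓_) (drop k s)) + (k ⊓ 2) * h ∎
      where
      open ≤-Reasoning
      k = suc j
      M = sum (map (k ⊓_) (drop k D))
      lem : ∀ a m b c → a + m + (b + c) ≡ a + (b + m) + c
      lem = solve-∀
    -- The second copy lies among the first k entries: e joins the chosen vertices. Its surplus d
    -- strengthens the bound, and the remaining extras sum to 2h - d, which accounts for the slack d
    -- + d.
    ... | inj₂ (l , refl , take↭ , drop≡) = begin
            sum (take k s)
              ≡⟨ sum-↭ take↭ ⟩
            r + sum (take (suc l) D)
              ≤⟨ ≤-from (d + d) (+-mono-≤ bound (sum-⊓-≤ k E′)) (lem r d (sum (take (suc l) D)) (k * suc l + M) _ (sum E′)) ⟩
            k * suc l + M + (d + sum E′)
              ≡⟨ cong (k * suc l + M +_) (trans excess (lem₂ h)) ⟩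
            k * suc l + M + 2 * h
              ≡⟨ cong₂ (λ x n → k * suc l + sum (map (k ⊓_) x) + suc (suc n) * h) (≡.sym drop≡) (≡.sym (⊓-zeroʳ l)) ⟩
            k * suc l + sum (map (k ⊓_) (drop k s)) + (k ⊓ 2) * h ∎
      where
      open ≤-Reasoning
      k = suc (suc l)
      M = sum (map (k ⊓_) (drop (suc l) D))
      perm-k : L ↭ ((r + d) ∷ take (suc l) D) ++ (drop (suc l) D ++ E′)
      perm-k = ↭-trans (perm-at (suc l)) (↭-trans
        (++⁺ˡ (take (suc l) D) (↭-trans (++⁺ˡ (drop (suc l) D) E↭) (shift (r + d) (drop (suc l) D) E′)))
        (shift (r + d) (take (suc l) D) (drop (suc l) D ++ E′)))
      bound : r + d + sum (take (suc l) D) ≤ k * suc l + M + sum (map (k ⊓_) E′)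
      bound = bound-at k ((r + d) ∷ take (suc l) D) (drop (suc l) D) E′ perm-k
                (cong suc (length-take-≤ (suc l) D (<⇒≤ j<n)))
      lem : ∀ r d T X me e → r + T + (X + me + e) + (d + d) ≡ X + (d + e) + (r + d + T + me)
      lem = solve-∀
      lem₂ : ∀ h → h + h ≡ 2 * h
      lem₂ = solve-∀

-- The two bounds meet

-- Strict descent to an entry that is at least 2 forces d_1 ≥ n + 1, by induction from the tail.
length<head : ∀ {x xs} → AllPairs _>_ (x ∷ xs) → All (2 ≤_) (x ∷ xs) → suc (length xs) < x
length<head {x} {[]}     _                        (2≤x ∷ _)    = 2≤x
length<head {x} {y ∷ ys} ((x>y ∷ _) ∷ decr) (_ ∷ all≥2) = ≤-trans (s≤s (length<head decr all≥2)) x>y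

dup-⊆ : ∀ (A : List ℕ) {r B d} → d ∈ A ++ r ∷ r ∷ B → d ∈ A ++ r ∷ B
dup-⊆ []      (here eq)  = here eq
dup-⊆ []      (there d∈) = d∈
dup-⊆ (x ∷ A) (here eq)  = here eq
dup-⊆ (x ∷ A) (there d∈) = there (dup-⊆ A d∈)

dup-⊇ : ∀ (A : List ℕ) {r B d} → d ∈ A ++ r ∷ B → d ∈ A ++ r ∷ r ∷ B
dup-⊇ []      d∈         = there d∈
dup-⊇ (x ∷ A) (here eq)  = here eq
dup-⊇ (x ∷ A) (there d∈) = there (dup-⊇ A d∈)

dup-sorted : ∀ A {r B} → AllPairs _≥_ (A ++ r ∷ B) → AllPairs _≥_ (A ++ r ∷ r ∷ B)
dup-sorted []      (r≥ ∷ sorted) = (≤-refl ∷ r≥) ∷ r≥ ∷ sorted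
dup-sorted (x ∷ A) (x≥ ∷ sorted) = All.tabulate (All.lookup x≥ ∘ dup-⊆ A) ∷ dup-sorted A sorted

-- Here s is D with repeated entries of total a adjoined: none when σ(D) is even, d_r when it is odd.
minimum : ∀ D s K a → (∀ {d} → d ∈ s → d ∈ D) → (∀ {d} → d ∈ D → d ∈ s) → sum s ≡ σ D + a →
  (∃ λ x → ∃ λ xs → s ≡ x ∷ xs × length xs ≡ suc K × suc K < x) →
  AllPairs _≥_ s → All (2 ≤_) s → 2 ∈ s → odd (sum s) ≡ false →
  (∀ {N} (G : SimpleGraph N) → HasDegreeSet G D →
     ∃ λ h → edgeCount G + edgeCount G ≡ σ D + a + (h + h) × (∀ j → j ≤ K → Covers s (suc j) h)) →
  Σ ℕ λ ℓ → IsLq D ℓ × (ℤ.+ (2 * ℓ) ≡ ℤ.+ σ D ℤ.+ ℤ.+ 2 ℤ.* maxTerm s K ℤ.+ ℤ.+ a)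
minimum D s K a s⊆D D⊆s sum≡ (x , xs , s≡ , len , big) sorted s≥2 2∈s even lower
  with maxTerm-natural x xs K (subst (_< x) (≡.sym len) big)
... | c , C≡
  with Padding.padded-graph s c K x xs s≡ len sorted s≥2 2∈s big even
         (maxTerm≤⇒Covers s K c (ℤ.≤-reflexive (trans (cong (λ s → maxTerm s K) s≡) C≡)))
... | N , G , member , attained , edges =
  edgeCount G , ((N , G , ((s⊆D ∘ member) , (λ d → attained d ∘ D⊆s)) , refl) , least) , formula
  where
  edges′ : edgeCount G + edgeCount G ≡ σ D + a + (c + c)
  edges′ = trans edges (cong (_+ (c + c)) sum≡)
  C≡′ : maxTerm s K ≡ ℤ.+ c
  C≡′ = trans (cong (λ s → maxTerm s K) s≡) C≡
  least : ∀ M (H : SimpleGraph M) → HasDegreeSet H D → edgeCount G ≤ edgeCount H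
  least M H degs with lower H degs
  ... | h , edges-H , cov = m+m≤n+n⇒m≤n (subst₂ _≤_ (≡.sym edges′) (≡.sym edges-H)
          (+-monoʳ-≤ (σ D + a) (+-mono-≤ c≤h c≤h)))
    where
    c≤h : c ≤ h
    c≤h = ℤ.drop‿+≤+ (subst (ℤ._≤ ℤ.+ h) C≡′ (Covers⇒maxTerm≤ s K h cov))
  formula : ℤ.+ (2 * edgeCount G) ≡ ℤ.+ σ D ℤ.+ ℤ.+ 2 ℤ.* maxTerm s K ℤ.+ ℤ.+ a
  formula = begin
    ℤ.+ (2 * edgeCount G)                     ≡⟨ cong ℤ.+_ (trans (lem₁ (edgeCount G)) (trans edges′ (lem₂ (σ D) a c))) ⟩
    ℤ.+ (σ D + 2 * c + a)                     ≡⟨ ℤ.pos-+ (σ D + 2 * c) a ⟩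
    ℤ.+ (σ D + 2 * c) ℤ.+ ℤ.+ a               ≡⟨ cong (ℤ._+ ℤ.+ a) (ℤ.pos-+ (σ D) (2 * c)) ⟩
    ℤ.+ σ D ℤ.+ ℤ.+ (2 * c) ℤ.+ ℤ.+ a         ≡⟨ cong (λ z → ℤ.+ σ D ℤ.+ z ℤ.+ ℤ.+ a)
                                                   (trans (ℤ.pos-* 2 c) (cong (ℤ._*_ (ℤ.+ 2)) (≡.sym C≡′))) ⟩
    ℤ.+ σ D ℤ.+ ℤ.+ 2 ℤ.* maxTerm s K ℤ.+ ℤ.+ a ∎
    where
    open ≡-Reasoning
    lem₁ : ∀ e → 2 * e ≡ e + e
    lem₁ = solve-∀
    lem₂ : ∀ s a c → s + a + (c + c) ≡ s + 2 * c + a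
    lem₂ = solve-∀

even-case : ∀ D → AllPairs _>_ D → 2 ≤ length D → All (2 ≤_) D → 2 ∈ D → odd (σ D) ≡ false →
  Σ ℕ λ ℓ → IsLq D ℓ × (ℤ.+ (2 * ℓ) ≡ ℤ.+ σ D ℤ.+ ℤ.+ 2 ℤ.* maxTerm D (length D ∸ 2) ℤ.+ ℤ.+ 0)
even-case D@(x ∷ y ∷ ys) decr _ D≥2 2∈D even =
  minimum D D (length ys) 0 id id (≡.sym (+-identityʳ (sum D)))
    (x , y ∷ ys , refl , refl , <-trans (n<1+n _) (length<head decr D≥2))
    (AllPairs.map <⇒≤ decr) D≥2 2∈D even lower
  where
  lower : ∀ {N} (G : SimpleGraph N) → HasDegreeSet G D →
    ∃ λ h → edgeCount G + edgeCount G ≡ σ D + 0 + (h + h) × (∀ j → j ≤ length ys → Covers D (suc j) h)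
  lower G degs with even-lower G decr D≥2 degs even
  ... | h , edges , cov = h , trans edges (cong (_+ (h + h)) (≡.sym (+-identityʳ (sum D)))) ,
                          λ j j≤ → cov j (s≤s (m≤n⇒m≤1+n j≤))
even-case (_ ∷ []) _ (s≤s ()) _ _ _

odd-case : ∀ D → AllPairs _>_ D → 2 ≤ length D → All (2 ≤_) D → 2 ∈ D → odd (σ D) ≡ true →
  Σ ℕ λ ℓ → IsLq D ℓ × (ℤ.+ (2 * ℓ) ≡ ℤ.+ σ D ℤ.+ ℤ.+ 2 ℤ.* maxTerm (dupLastOdd D) (length D ∸ 1) ℤ.+ ℤ.+ lastOdd D)
odd-case D decr 2≤n D≥2 2∈D odd-σ = result
  where
  lo : LastOdd D
  lo = let _ , x∈ , ox = odd-member D odd-σ in last-odd D (any-odd x∈ ox)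
  open LastOdd lo
  s = A ++ r ∷ r ∷ B
  s⊆D : ∀ {d} → d ∈ s → d ∈ D
  s⊆D d∈ = subst (_ ∈_) (≡.sym D≡) (dup-⊆ A d∈)
  D⊆s : ∀ {d} → d ∈ D → d ∈ s
  D⊆s d∈ = dup-⊇ A (subst (_ ∈_) D≡ d∈)
  sum≡ : sum s ≡ sum D + r
  sum≡ = trans (sum-↭ (shift r A (r ∷ B))) (trans (+-comm r _) (cong (λ xs → sum xs + r) (≡.sym D≡)))
  length≡ : length s ≡ suc (length D)
  length≡ = trans (↭-length (shift r A (r ∷ B))) (cong (suc ∘ length) (≡.sym D≡))
  n≡ : length D ≡ suc (length D ∸ 1)
  n≡ = ≡.sym (m+[n∸m]≡n (<⇒≤ 2≤n))
  -- The duplicate leaves n entries after the first one, so n < d_1 is exactly the bound that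
  -- `minimum` asks for.
  first : ∀ A {B} → AllPairs _>_ (A ++ r ∷ B) → All (2 ≤_) (A ++ r ∷ B) →
    ∃ λ x → ∃ λ xs → A ++ r ∷ r ∷ B ≡ x ∷ xs × length (A ++ r ∷ B) < x
  first []      decr all≥2 = r , _ , refl , length<head decr all≥2
  first (a ∷ A) decr all≥2 = a , _ , refl , length<head decr all≥2
  head : ∃ λ x → ∃ λ xs → s ≡ x ∷ xs × length xs ≡ suc (length D ∸ 1) × suc (length D ∸ 1) < x
  head with first A (subst (AllPairs _>_) D≡ decr) (subst (All (2 ≤_)) D≡ D≥2)
  ... | x , xs , s≡ , big = x , xs , s≡ ,
        suc-injective (trans (≡.sym (cong length s≡)) (trans length≡ (cong suc n≡))) ,
        subst (_< x) (trans (cong length (≡.sym D≡)) n≡) big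
  even : odd (sum s) ≡ false
  even = trans (cong odd sum≡) (trans (odd-+ (sum D) r) (cong₂ _xor_ odd-σ r-odd))
  result : Σ ℕ λ ℓ → IsLq D ℓ × (ℤ.+ (2 * ℓ) ≡ ℤ.+ σ D ℤ.+ ℤ.+ 2 ℤ.* maxTerm (dupLastOdd D) (length D ∸ 1) ℤ.+ ℤ.+ lastOdd D)
  result rewrite dup≡ | lastOdd≡ = minimum D s (length D ∸ 1) r s⊆D D⊆s sum≡ head
    (dup-sorted A (subst (AllPairs _≥_) D≡ (AllPairs.map <⇒≤ decr))) (All.tabulate (All.lookup D≥2 ∘ s⊆D)) (D⊆s 2∈D) even
    (λ G degs → let h , edges , cov = odd-lower G decr D≥2 degs odd-σ lo in
                h , edges , λ j j≤ → cov j (subst (j <_) (≡.sym n≡) (s≤s j≤)))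

open import Data.Integer using (+_)

theorem5 : (D : List ℕ) → Linked _>_ D → 2 ≤ length D → All (2 ≤_) D → 2 ∈ D →
    Σ ℕ λ ℓ → IsLq D ℓ × (+ (2 Data.Nat.* ℓ) ≡ twiceFormula D)
theorem5 D linked 2≤n D≥2 2∈D with odd (σ D) in parity
... | true  = odd-case D (Linked⇒AllPairs (λ x>y y>z → <-trans y>z x>y) linked) 2≤n D≥2 2∈D parity
... | false = even-case D (Linked⇒AllPairs (λ x>y y>z → <-trans y>z x>y) linked) 2≤n D≥2 2∈D parity
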